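{- Let $n>2$ and $q>0$ be integers such that $n$ is even or $q$ is odd. Then for every prime $p>\max\{n,(q-1)n+1\}$, $$p^n\sum_{k=0}^{p-1}\frac{(1)_k^n}{(\frac{p}{n}-q+2)_k^n}\equiv 0\pmod{p^3}.$$
   Context: For a number $x$ and integer $k\ge0$, $(x)_k$ denotes the Pochhammer symbol: $(x)_0=1$ and $(x)_k=x(x+1)\cdots(x+k-1)$ for $k>0$. For rational numbers $a,b$ and a prime $p$, $a\equiv b\pmod{p^m}$ means that $a-b=p^m c$ for some rational number $c$ whose denominator is not divisible by $p$. -}

module Defs where

open import Data.Nat as ℕ using (ℕ; zero; suc)
open import Data.Integer as ℤ using (ℤ; +_)
open import Data.Rational as ℚ using (ℚ; 0ℚ; 1ℚ; _+_; _*_; _-_; _÷_)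
open import Data.Rational.Properties using (_≟_)
open import Data.Nat.Divisibility using (_∣_)
open import Data.Product using (∃; _×_)
open import Relation.Nullary using (¬_; yes; no)
open import Relation.Binary.PropositionalEquality using (_≡_)

ℕ→ℚ : ℕ → ℚ
ℕ→ℚ n = + n ℚ./ 1

pow : ℚ → ℕ → ℚ
pow x zero    = 1ℚ
pow x (suc k) = pow x k * x

-- total division; the convention x/0 = 0 is never used in the theorem,
-- since all denominators appearing there are nonzero
div : ℚ → ℚ → ℚ
div x y with y ≟ 0ℚ
... | yes _  = 0ℚ
... | no y≢0 = _÷_ x y {{ℚ.≢-nonZero y≢0}}

poch : ℚ → ℕ → ℚ
poch x zero    = 1ℚ
poch x (suc k) = poch x k * (x + ℕ→ℚ k)

sumTo : ℕ → (ℕ → ℚ) → ℚ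
sumTo zero    f = 0ℚ
sumTo (suc m) f = sumTo m f + f m

CongMod : ℚ → ℚ → ℕ → ℕ → Set
CongMod a b p m = ∃ λ (c : ℚ) → (a - b ≡ pow (ℕ→ℚ p) m * c) × ¬ (p ∣ ℚ.denominatorℕ c)

{-# OPTIONS --safe #-}
-- Write q = r + 1.  The terms with k < r are divisible by pⁿ.  For k = r + m the factor p/n of
-- the denominator cancels pⁿ, and the term becomes K · P(m) · G(m), where K is p-integral,
-- P(m) = ((m+1)⋯(m+r))ⁿ and G(m) = ∏_{i≤m} (1 + p/(n i))⁻ⁿ.  Expanding to second order,
--   G(m) ≡ (-1)ᵐ (p-1 choose m) · (1 + c H(m))  (mod p³)
-- with c = n(n+1)/2 · (p/n)² and H(m) = Σ_{i≤m} 1/i².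
-- The leading part sums to a (p-1)-st finite difference of a polynomial of degree rn < p - 1,
-- so it vanishes.  It remains to see that Σ P(m) H(m) ≡ 0 (mod p).  Up to the sign (-1)^{rn} = 1,
-- P is invariant modulo p under m ↦ p-1-r-m, whereas H(m) becomes H(p-1) - H(m+r).  Hence
-- twice the sum is congruent to -Σ P(m) (H(m+r) - H(m)), the sum of a polynomial of degree
-- below p - 1, and such sums vanish modulo p.
module Submission where

open import Defs
open import Data.Nat as ℕ using (ℕ; zero; suc; _<_; _∸_)
import Data.Nat.Properties as ℕₚ
open import Data.Nat.Coprimality using (Coprime; recompute)
open import Data.Nat.Divisibility using (_∣_; divides; ∣-trans; ∣-refl; ∣1⇒≡1; n∣m*n; >⇒∤)
open import Data.Nat.Primality using (Prime; euclidsLemma; ¬prime[1])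
open import Data.Integer as ℤ using (ℤ; +_; -[1+_]; ∣_∣; 0ℤ)
import Data.Integer.Divisibility.Signed as ℤ∣
import Data.Integer.Properties as ℤₚ
open import Data.Product using (_,_)
open import Data.Rational as ℚ using (ℚ; mkℚ; 0ℚ; 1ℚ; _+_; _*_; _-_; -_)
open import Data.Rational.Properties
open import Data.Rational.Solver using (module +-*-Solver)
import Data.Rational.Unnormalised as ℚᵘ
import Data.Rational.Unnormalised.Properties as ℚᵘₚ
open import Data.Sum using (_⊎_; inj₁; inj₂; [_,_]′)
open import Relation.Nullary using (¬_; Dec; yes; no; contradiction)
open import Relation.Binary.PropositionalEquality using (_≡_; _≢_; refl; sym; trans; cong; cong₂; subst; module ≡-Reasoning)
open +-*-Solver using (solve; _:+_; _:*_; _:-_; :-_; con; _:=_)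

-- The embedding of ℤ in ℚ, and total reciprocals.

ℤ→ℚ : ℤ → ℚ
ℤ→ℚ a = a ℚ./ 1

private
  -- `ℤ→ℚ` normalises its result and is stuck on a variable. Unnormalised fractions, compared by
  -- cross-multiplication, avoid the gcd.
  toℚᵘ-ℤ→ℚ : ∀ a → ℚ.toℚᵘ (ℤ→ℚ a) ℚᵘ.≃ ℚᵘ.mkℚᵘ a 0
  toℚᵘ-ℤ→ℚ a = toℚᵘ-fromℚᵘ (ℚᵘ.mkℚᵘ a 0)

ℤ→ℚ-+ : ∀ a b → ℤ→ℚ (a ℤ.+ b) ≡ ℤ→ℚ a + ℤ→ℚ b
ℤ→ℚ-+ a b = toℚᵘ-injective (begin
  ℚ.toℚᵘ (ℤ→ℚ (a ℤ.+ b))                    ≈⟨ toℚᵘ-ℤ→ℚ (a ℤ.+ b) ⟩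
  ℚᵘ.mkℚᵘ (a ℤ.+ b) 0                       ≈⟨ ℚᵘ.*≡* (cong (ℤ._* + 1) (cong₂ ℤ._+_ (sym (ℤₚ.*-identityʳ a)) (sym (ℤₚ.*-identityʳ b)))) ⟩
  ℚᵘ.mkℚᵘ a 0 ℚᵘ.+ ℚᵘ.mkℚᵘ b 0              ≈⟨ ℚᵘₚ.+-cong (toℚᵘ-ℤ→ℚ a) (toℚᵘ-ℤ→ℚ b) ⟨
  ℚ.toℚᵘ (ℤ→ℚ a) ℚᵘ.+ ℚ.toℚᵘ (ℤ→ℚ b)        ≈⟨ toℚᵘ-homo-+ (ℤ→ℚ a) (ℤ→ℚ b) ⟨
  ℚ.toℚᵘ (ℤ→ℚ a + ℤ→ℚ b)                    ∎)
  where open ℚᵘₚ.≃-Reasoning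

ℤ→ℚ-* : ∀ a b → ℤ→ℚ (a ℤ.* b) ≡ ℤ→ℚ a * ℤ→ℚ b
ℤ→ℚ-* a b = toℚᵘ-injective (begin
  ℚ.toℚᵘ (ℤ→ℚ (a ℤ.* b))                    ≈⟨ toℚᵘ-ℤ→ℚ (a ℤ.* b) ⟩
  ℚᵘ.mkℚᵘ a 0 ℚᵘ.* ℚᵘ.mkℚᵘ b 0              ≈⟨ ℚᵘₚ.*-cong (toℚᵘ-ℤ→ℚ a) (toℚᵘ-ℤ→ℚ b) ⟨
  ℚ.toℚᵘ (ℤ→ℚ a) ℚᵘ.* ℚ.toℚᵘ (ℤ→ℚ b)        ≈⟨ toℚᵘ-homo-* (ℤ→ℚ a) (ℤ→ℚ b) ⟨
  ℚ.toℚᵘ (ℤ→ℚ a * ℤ→ℚ b)                    ∎)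
  where open ℚᵘₚ.≃-Reasoning

ℤ→ℚ-injective : ∀ a b → ℤ→ℚ a ≡ ℤ→ℚ b → a ≡ b
ℤ→ℚ-injective a b eq with ℚᵘₚ.≃-trans (ℚᵘₚ.≃-sym (toℚᵘ-ℤ→ℚ a)) (ℚᵘₚ.≃-trans (ℚᵘₚ.≃-reflexive (cong ℚ.toℚᵘ eq)) (toℚᵘ-ℤ→ℚ b))
... | ℚᵘ.*≡* e = trans (sym (ℤₚ.*-identityʳ a)) (trans e (ℤₚ.*-identityʳ b))

ℕ→ℚ-+ : ∀ m n → ℕ→ℚ (m ℕ.+ n) ≡ ℕ→ℚ m + ℕ→ℚ n
ℕ→ℚ-+ m n = ℤ→ℚ-+ (+ m) (+ n)

ℕ→ℚ-suc : ∀ n → ℕ→ℚ (suc n) ≡ 1ℚ + ℕ→ℚ n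
ℕ→ℚ-suc n = ℕ→ℚ-+ 1 n

ℕ→ℚ-suc≢0 : ∀ n → ℕ→ℚ (suc n) ≢ 0ℚ
ℕ→ℚ-suc≢0 n eq with ℤ→ℚ-injective (+ suc n) 0ℤ eq
... | ()

*-denominator : ∀ (c : ℚ) → c * ℕ→ℚ (ℚ.denominatorℕ c) ≡ ℤ→ℚ (ℚ.numerator c)
*-denominator c@record{} = toℚᵘ-injective (begin
  ℚ.toℚᵘ (c * ℕ→ℚ (ℚ.denominatorℕ c))           ≈⟨ toℚᵘ-homo-* c (ℕ→ℚ (ℚ.denominatorℕ c)) ⟩
  ℚ.toℚᵘ c ℚᵘ.* ℚ.toℚᵘ (ℕ→ℚ (ℚ.denominatorℕ c))    ≈⟨ ℚᵘₚ.*-congˡ {ℚ.toℚᵘ c} (toℚᵘ-ℤ→ℚ (+ ℚ.denominatorℕ c)) ⟩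
  ℚ.toℚᵘ c ℚᵘ.* ℚᵘ.mkℚᵘ (+ ℚ.denominatorℕ c) 0       ≈⟨ ℚᵘ.*≡* (trans (ℤₚ.*-identityʳ _) (cong (λ z → ℚ.numerator c ℤ.* + z) (sym (ℕₚ.*-identityʳ (ℚ.denominatorℕ c))))) ⟩
  ℚᵘ.mkℚᵘ (ℚ.numerator c) 0                    ≈⟨ toℚᵘ-ℤ→ℚ (ℚ.numerator c) ⟨
  ℚ.toℚᵘ (ℤ→ℚ (ℚ.numerator c))                    ∎)
  where open ℚᵘₚ.≃-Reasoning

-- Total reciprocal, with inv 0 = 0.
inv : ℚ → ℚ
inv = div 1ℚ

div-inv : ∀ x y → div x y ≡ x * inv y
div-inv x y with y ≟ 0ℚ
... | yes _  = sym (*-zeroʳ x)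
... | no y≢0 = cong (x *_) (sym (*-identityˡ _))

*-inv : ∀ y → y ≢ 0ℚ → y * inv y ≡ 1ℚ
*-inv y y≢0 with y ≟ 0ℚ
... | yes y≡0 = contradiction y≡0 y≢0
... | no y≢0 = trans (cong (y *_) (*-identityˡ _)) (*-inverseʳ y {{ℚ.≢-nonZero y≢0}})

inv-unique : ∀ x y → x * y ≡ 1ℚ → inv x ≡ y
inv-unique x y xy≡1 = begin
  inv x              ≡⟨ *-identityʳ (inv x) ⟨
  inv x * 1ℚ         ≡⟨ cong (inv x *_) xy≡1 ⟨
  inv x * (x * y)    ≡⟨ solve 3 (λ i x y → i :* (x :* y) := x :* i :* y) refl (inv x) x y ⟩
  x * inv x * y      ≡⟨ cong (_* y) (*-inv x x≢0) ⟩
  1ℚ * y             ≡⟨ *-identityˡ y ⟩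
  y                  ∎
  where
  open ≡-Reasoning
  x≢0 : x ≢ 0ℚ
  x≢0 x≡0 = 1≢0 (trans (sym xy≡1) (trans (cong (_* y) x≡0) (*-zeroˡ y)))

-- The convention `inv 0 = 0` settles the degenerate cases, so products in denominators split
-- without side conditions.
inv-* : ∀ x y → inv (x * y) ≡ inv x * inv y
inv-* x y = by-cases (x ≟ 0ℚ) (y ≟ 0ℚ)
  where
  open ≡-Reasoning
  by-cases : Dec (x ≡ 0ℚ) → Dec (y ≡ 0ℚ) → inv (x * y) ≡ inv x * inv y
  by-cases (yes refl) _          = trans (cong inv (*-zeroˡ y)) (sym (*-zeroˡ (inv y)))
  by-cases (no _)     (yes refl) = trans (cong inv (*-zeroʳ x)) (sym (*-zeroʳ (inv x)))
  by-cases (no x≢0)   (no y≢0)   = inv-unique (x * y) (inv x * inv y) (begin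
    x * y * (inv x * inv y)    ≡⟨ solve 4 (λ x y i j → x :* y :* (i :* j) := x :* i :* (y :* j)) refl x y (inv x) (inv y) ⟩
    x * inv x * (y * inv y)    ≡⟨ cong₂ _*_ (*-inv x x≢0) (*-inv y y≢0) ⟩
    1ℚ                         ∎)

-- Powers and finite sums.

pow-* : ∀ x y k → pow (x * y) k ≡ pow x k * pow y k
pow-* x y zero    = refl
pow-* x y (suc k) = trans (cong (_* (x * y)) (pow-* x y k))
  (solve 4 (λ a b x y → a :* b :* (x :* y) := a :* x :* (b :* y)) refl (pow x k) (pow y k) x y)

pow-+ : ∀ x j k → pow x (j ℕ.+ k) ≡ pow x j * pow x k
pow-+ x zero    k = sym (*-identityˡ _)
pow-+ x (suc j) k = trans (cong (_* x) (pow-+ x j k))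
  (solve 3 (λ a b x → a :* b :* x := a :* x :* b) refl (pow x j) (pow x k) x)

pow-1 : ∀ k → pow 1ℚ k ≡ 1ℚ
pow-1 zero    = refl
pow-1 (suc k) = trans (*-identityʳ _) (pow-1 k)

pow-inv : ∀ x k → pow (inv x) k ≡ inv (pow x k)
pow-inv x zero    = refl
pow-inv x (suc k) = trans (cong (_* inv x) (pow-inv x k)) (sym (inv-* (pow x k) x))

sumTo-cong : ∀ m {f g} → (∀ i → i < m → f i ≡ g i) → sumTo m f ≡ sumTo m g
sumTo-cong zero    f≗g = refl
sumTo-cong (suc m) f≗g = cong₂ _+_ (sumTo-cong m (λ i i<m → f≗g i (ℕₚ.m<n⇒m<1+n i<m))) (f≗g m ℕₚ.≤-refl)

sumTo-+ : ∀ m f g → sumTo m f + sumTo m g ≡ sumTo m (λ i → f i + g i)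
sumTo-+ zero    f g = refl
sumTo-+ (suc m) f g = trans
  (solve 4 (λ s t a b → s :+ a :+ (t :+ b) := s :+ t :+ (a :+ b)) refl (sumTo m f) (sumTo m g) (f m) (g m))
  (cong (_+ (f m + g m)) (sumTo-+ m f g))

sumTo-* : ∀ m c f → c * sumTo m f ≡ sumTo m (λ i → c * f i)
sumTo-* zero    c f = *-zeroʳ c
sumTo-* (suc m) c f = trans (*-distribˡ-+ c (sumTo m f) (f m)) (cong (_+ c * f m) (sumTo-* m c f))

sumTo-shift : ∀ m f → sumTo (suc m) f ≡ f 0 + sumTo m (λ i → f (suc i))
sumTo-shift zero    f = trans (+-identityˡ (f 0)) (sym (+-identityʳ (f 0)))
sumTo-shift (suc m) f = trans (cong (_+ f (suc m)) (sumTo-shift m f)) (+-assoc (f 0) _ _)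

sumTo-split : ∀ r l f → sumTo (r ℕ.+ l) f ≡ sumTo r f + sumTo l (λ i → f (r ℕ.+ i))
sumTo-split zero    l f = sym (+-identityˡ _)
sumTo-split (suc r) l f = begin
  sumTo (suc r ℕ.+ l) f                                                   ≡⟨ sumTo-shift (r ℕ.+ l) f ⟩
  f 0 + sumTo (r ℕ.+ l) (λ i → f (suc i))                                 ≡⟨ cong (λ s → f 0 + s) (sumTo-split r l (λ i → f (suc i))) ⟩
  f 0 + (sumTo r (λ i → f (suc i)) + sumTo l (λ i → f (suc r ℕ.+ i)))     ≡⟨ +-assoc (f 0) _ _ ⟨
  f 0 + sumTo r (λ i → f (suc i)) + sumTo l (λ i → f (suc r ℕ.+ i))       ≡⟨ cong (_+ sumTo l (λ i → f (suc r ℕ.+ i))) (sumTo-shift r f) ⟨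
  sumTo (suc r) f + sumTo l (λ i → f (suc r ℕ.+ i))                       ∎
  where open ≡-Reasoning

sumTo-reverse : ∀ m f → sumTo m f ≡ sumTo m (λ i → f (m ∸ suc i))
sumTo-reverse zero    f = refl
sumTo-reverse (suc m) f = begin
  sumTo m f + f m                                  ≡⟨ +-comm (sumTo m f) (f m) ⟩
  f m + sumTo m f                                  ≡⟨ cong (λ s → f m + s) (sumTo-reverse m f) ⟩
  f m + sumTo m (λ i → f (m ∸ suc i))            ≡⟨ sumTo-shift m (λ i → f (m ∸ i)) ⟨
  sumTo (suc m) (λ i → f (m ∸ i))                ∎
  where open ≡-Reasoning

-- The localisation of ℤ at p

-- Clearing by some multiplier prime to p, not by the reduced denominator: closure under sums and
-- products then needs only Euclid's lemma.
record Integral (p : ℕ) (x : ℚ) : Set where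
  constructor integral
  field
    multiplier : ℤ
    multiple   : ℤ
    p∤mult     : ¬ (p ∣ ∣ multiplier ∣)
    clears     : x * ℤ→ℚ multiplier ≡ ℤ→ℚ multiple

-- The ideal generated by p^j in the localisation; a congruence modulo p^j is membership of the
-- difference.
record Ideal (p j : ℕ) (x : ℚ) : Set where
  constructor ideal
  field
    cofactor          : ℚ
    cofactor-integral : Integral p cofactor
    factorises        : x ≡ pow (ℕ→ℚ p) j * cofactor

module Localisation (p : ℕ) (p-prime : Prime p) where

  p∤1 : ¬ (p ∣ 1)
  p∤1 p∣1 = ¬prime[1] (subst Prime (∣1⇒≡1 p∣1) p-prime)

  -- Cross-multiplication gives num · d = a · den. If p divided den, it would divide num, against
  -- reducedness, or d.
  integral⇒p∤denominator : ∀ {x} → Integral p x → ¬ (p ∣ ℚ.denominatorℕ x)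
  integral⇒p∤denominator {x@(mkℚ num d-1 cop)} (integral d a p∤d x*d≡a) p∣den =
    [ (λ p∣num → p∤1 (subst (p ∣_) (cop′ (p∣num , p∣den)) ∣-refl)) , p∤d ]′ (euclidsLemma ∣ num ∣ ∣ d ∣ p-prime p∣num*d)
    where
    open ≡-Reasoning
    cop′ : Coprime ∣ num ∣ (suc d-1)
    -- The coprimality field of `mkℚ` is irrelevant; `recompute` makes it usable.
    cop′ = recompute cop
    cross : ℤ→ℚ (num ℤ.* d) ≡ ℤ→ℚ (a ℤ.* + suc d-1)
    cross = begin
      ℤ→ℚ (num ℤ.* d)                       ≡⟨ ℤ→ℚ-* num d ⟩
      ℤ→ℚ num * ℤ→ℚ d                       ≡⟨ cong (_* ℤ→ℚ d) (*-denominator x) ⟨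
      x * ℕ→ℚ (suc d-1) * ℤ→ℚ d             ≡⟨ solve 3 (λ x e d → x :* e :* d := x :* d :* e) refl x (ℕ→ℚ (suc d-1)) (ℤ→ℚ d) ⟩
      x * ℤ→ℚ d * ℕ→ℚ (suc d-1)             ≡⟨ cong (_* ℕ→ℚ (suc d-1)) x*d≡a ⟩
      ℤ→ℚ a * ℕ→ℚ (suc d-1)                 ≡⟨ ℤ→ℚ-* a (+ suc d-1) ⟨
      ℤ→ℚ (a ℤ.* + suc d-1)                 ∎
    p∣num*d : p ∣ ∣ num ∣ ℕ.* ∣ d ∣
    p∣num*d = subst (p ∣_) (begin
      ∣ a ∣ ℕ.* suc d-1          ≡⟨ ℤₚ.abs-* a (+ suc d-1) ⟨
      ∣ a ℤ.* + suc d-1 ∣        ≡⟨ cong ∣_∣ (ℤ→ℚ-injective (num ℤ.* d) (a ℤ.* + suc d-1) cross) ⟨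
      ∣ num ℤ.* d ∣              ≡⟨ ℤₚ.abs-* num d ⟩
      ∣ num ∣ ℕ.* ∣ d ∣          ∎) (∣-trans p∣den (n∣m*n ∣ a ∣))

  p∤-* : ∀ a b → ¬ (p ∣ ∣ a ∣) → ¬ (p ∣ ∣ b ∣) → ¬ (p ∣ ∣ a ℤ.* b ∣)
  p∤-* a b p∤a p∤b p∣ab =
    [ p∤a , p∤b ]′ (euclidsLemma ∣ a ∣ ∣ b ∣ p-prime (subst (p ∣_) (ℤₚ.abs-* a b) p∣ab))

  integral-ℤ : ∀ a → Integral p (ℤ→ℚ a)
  integral-ℤ a = integral (+ 1) a p∤1 (*-identityʳ (ℤ→ℚ a))

  integral-ℕ : ∀ m → Integral p (ℕ→ℚ m)
  integral-ℕ m = integral-ℤ (+ m)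

  integral-+ : ∀ {x y} → Integral p x → Integral p y → Integral p (x + y)
  integral-+ {x} {y} (integral d a p∤d xd≡a) (integral e b p∤e ye≡b) =
    integral (d ℤ.* e) (a ℤ.* e ℤ.+ b ℤ.* d) (p∤-* d e p∤d p∤e) (begin
      (x + y) * ℤ→ℚ (d ℤ.* e)                   ≡⟨ cong ((x + y) *_) (ℤ→ℚ-* d e) ⟩
      (x + y) * (ℤ→ℚ d * ℤ→ℚ e)                 ≡⟨ solve 4 (λ x y d e → (x :+ y) :* (d :* e) := x :* d :* e :+ y :* e :* d) refl x y (ℤ→ℚ d) (ℤ→ℚ e) ⟩
      x * ℤ→ℚ d * ℤ→ℚ e + y * ℤ→ℚ e * ℤ→ℚ d     ≡⟨ cong₂ (λ s t → s * ℤ→ℚ e + t * ℤ→ℚ d) xd≡a ye≡b ⟩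
      ℤ→ℚ a * ℤ→ℚ e + ℤ→ℚ b * ℤ→ℚ d             ≡⟨ cong₂ _+_ (ℤ→ℚ-* a e) (ℤ→ℚ-* b d) ⟨
      ℤ→ℚ (a ℤ.* e) + ℤ→ℚ (b ℤ.* d)             ≡⟨ ℤ→ℚ-+ (a ℤ.* e) (b ℤ.* d) ⟨
      ℤ→ℚ (a ℤ.* e ℤ.+ b ℤ.* d)                 ∎)
    where open ≡-Reasoning

  integral-* : ∀ {x y} → Integral p x → Integral p y → Integral p (x * y)
  integral-* {x} {y} (integral d a p∤d xd≡a) (integral e b p∤e ye≡b) =
    integral (d ℤ.* e) (a ℤ.* b) (p∤-* d e p∤d p∤e) (begin
      x * y * ℤ→ℚ (d ℤ.* e)         ≡⟨ cong (x * y *_) (ℤ→ℚ-* d e) ⟩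
      x * y * (ℤ→ℚ d * ℤ→ℚ e)       ≡⟨ solve 4 (λ x y d e → x :* y :* (d :* e) := x :* d :* (y :* e)) refl x y (ℤ→ℚ d) (ℤ→ℚ e) ⟩
      x * ℤ→ℚ d * (y * ℤ→ℚ e)       ≡⟨ cong₂ _*_ xd≡a ye≡b ⟩
      ℤ→ℚ a * ℤ→ℚ b                 ≡⟨ ℤ→ℚ-* a b ⟨
      ℤ→ℚ (a ℤ.* b)                 ∎)
    where open ≡-Reasoning

  integral-neg : ∀ {x} → Integral p x → Integral p (- x)
  integral-neg {x} x-int = subst (Integral p) (solve 1 (λ x → con (- 1ℚ) :* x := :- x) refl x)
    (integral-* (integral-ℤ (-[1+ 0 ])) x-int)

  integral-pow : ∀ {x} k → Integral p x → Integral p (pow x k)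
  integral-pow zero    x-int = integral-ℕ 1
  integral-pow (suc k) x-int = integral-* (integral-pow k x-int) x-int

  p∤⇒≢0 : ∀ x d a → ¬ (p ∣ ∣ a ∣) → x * ℤ→ℚ d ≡ ℤ→ℚ a → x ≢ 0ℚ
  p∤⇒≢0 x d a p∤a xd≡a x≡0 = p∤a (subst (λ z → p ∣ ∣ z ∣) (sym a≡0) (divides 0 refl))
    where
    a≡0 : a ≡ 0ℤ
    a≡0 = ℤ→ℚ-injective a 0ℤ (trans (sym xd≡a) (trans (cong (_* ℤ→ℚ d) x≡0) (*-zeroˡ (ℤ→ℚ d))))

  -- The clearing relation read backwards: `a` becomes the multiplier of `inv x` and `d` the
  -- multiple.
  integral-inv : ∀ x d a → ¬ (p ∣ ∣ a ∣) → x * ℤ→ℚ d ≡ ℤ→ℚ a → Integral p (inv x)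
  integral-inv x d a p∤a xd≡a = integral a d p∤a (begin
    inv x * ℤ→ℚ a            ≡⟨ cong (inv x *_) xd≡a ⟨
    inv x * (x * ℤ→ℚ d)      ≡⟨ solve 3 (λ i x d → i :* (x :* d) := x :* i :* d) refl (inv x) x (ℤ→ℚ d) ⟩
    x * inv x * ℤ→ℚ d        ≡⟨ cong (_* ℤ→ℚ d) (*-inv x (p∤⇒≢0 x d a p∤a xd≡a)) ⟩
    1ℚ * ℤ→ℚ d               ≡⟨ *-identityˡ (ℤ→ℚ d) ⟩
    ℤ→ℚ d                    ∎)
    where open ≡-Reasoning

  ideal-+ : ∀ {j x y} → Ideal p j x → Ideal p j y → Ideal p j (x + y)
  ideal-+ {j} (ideal c c-int x≡) (ideal d d-int y≡) =
    ideal (c + d) (integral-+ c-int d-int) (trans (cong₂ _+_ x≡ y≡) (sym (*-distribˡ-+ (pow (ℕ→ℚ p) j) c d)))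

  ideal-* : ∀ {j k x y} → Ideal p j x → Ideal p k y → Ideal p (j ℕ.+ k) (x * y)
  ideal-* {j} {k} (ideal c c-int x≡) (ideal d d-int y≡) =
    ideal (c * d) (integral-* c-int d-int) (begin
      _ ≡⟨ cong₂ _*_ x≡ y≡ ⟩
      pow (ℕ→ℚ p) j * c * (pow (ℕ→ℚ p) k * d)     ≡⟨ solve 4 (λ a b c d → a :* c :* (b :* d) := a :* b :* (c :* d)) refl (pow (ℕ→ℚ p) j) (pow (ℕ→ℚ p) k) c d ⟩
      pow (ℕ→ℚ p) j * pow (ℕ→ℚ p) k * (c * d)     ≡⟨ cong (_* (c * d)) (pow-+ (ℕ→ℚ p) j k) ⟨
      pow (ℕ→ℚ p) (j ℕ.+ k) * (c * d)             ∎)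
    where open ≡-Reasoning

  integral⇒ideal : ∀ {x} → Integral p x → Ideal p 0 x
  integral⇒ideal {x} x-int = ideal x x-int (sym (*-identityˡ x))

  ideal⇒integral : ∀ {j x} → Ideal p j x → Integral p x
  ideal⇒integral {j} (ideal c c-int x≡) =
    subst (Integral p) (sym x≡) (integral-* (integral-pow j (integral-ℕ p)) c-int)

  ideal-*ˡ : ∀ {j x y} → Integral p x → Ideal p j y → Ideal p j (x * y)
  ideal-*ˡ x-int y-id = ideal-* (integral⇒ideal x-int) y-id

  ideal-*ʳ : ∀ {j x y} → Ideal p j x → Integral p y → Ideal p j (x * y)
  ideal-*ʳ {j} {x} {y} x-id y-int = subst (Ideal p j) (*-comm y x) (ideal-*ˡ y-int x-id)

  ideal-neg : ∀ {j x} → Ideal p j x → Ideal p j (- x)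
  ideal-neg {j} {x} x-id = subst (Ideal p j) (solve 1 (λ x → con (- 1ℚ) :* x := :- x) refl x)
    (ideal-*ˡ (integral-ℤ (-[1+ 0 ])) x-id)

  ideal-- : ∀ {j x y} → Ideal p j x → Ideal p j y → Ideal p j (x - y)
  ideal-- x-id y-id = ideal-+ x-id (ideal-neg y-id)

  ideal-0 : ∀ {j} → Ideal p j 0ℚ
  ideal-0 {j} = ideal 0ℚ (integral-ℕ 0) (sym (*-zeroʳ (pow (ℕ→ℚ p) j)))

  ideal-pow : ∀ k → Ideal p k (pow (ℕ→ℚ p) k)
  ideal-pow k = ideal 1ℚ (integral-ℕ 1) (sym (*-identityʳ _))

  ideal-p : Ideal p 1 (ℕ→ℚ p)
  ideal-p = subst (Ideal p 1) (*-identityˡ (ℕ→ℚ p)) (ideal-pow 1)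

  ideal-weaken : ∀ {j k x} → j ℕ.≤ k → Ideal p k x → Ideal p j x
  ideal-weaken {j} {k} j≤k (ideal c c-int x≡) =
    ideal (pow (ℕ→ℚ p) (k ∸ j) * c) (integral-* (integral-pow (k ∸ j) (integral-ℕ p)) c-int) (begin
      _                                                   ≡⟨ x≡ ⟩
      pow (ℕ→ℚ p) k * c                                   ≡⟨ cong (λ i → pow (ℕ→ℚ p) i * c) (ℕₚ.m+[n∸m]≡n j≤k) ⟨
      pow (ℕ→ℚ p) (j ℕ.+ (k ∸ j)) * c                   ≡⟨ cong (_* c) (pow-+ (ℕ→ℚ p) j (k ∸ j)) ⟩
      pow (ℕ→ℚ p) j * pow (ℕ→ℚ p) (k ∸ j) * c           ≡⟨ *-assoc (pow (ℕ→ℚ p) j) _ c ⟩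
      pow (ℕ→ℚ p) j * (pow (ℕ→ℚ p) (k ∸ j) * c)         ∎)
    where open ≡-Reasoning

  ideal-sumTo : ∀ {j} m {f} → (∀ i → i < m → Ideal p j (f i)) → Ideal p j (sumTo m f)
  ideal-sumTo zero    f-id = ideal-0
  ideal-sumTo (suc m) f-id = ideal-+ (ideal-sumTo m (λ i i<m → f-id i (ℕₚ.m<n⇒m<1+n i<m))) (f-id m ℕₚ.≤-refl)

-- Finite differences

Δ : (ℕ → ℚ) → ℕ → ℚ
Δ f m = f (suc m) - f m

-- A polynomial of degree below d is represented by the vanishing of its d-th difference, so no
-- coefficients have to be handled.
DegreeBelow : ℕ → (ℕ → ℚ) → Set
DegreeBelow zero    f = ∀ m → f m ≡ 0ℚ
DegreeBelow (suc d) f = DegreeBelow d (Δ f)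

degreeBelow-cong : ∀ d {f g} → (∀ m → f m ≡ g m) → DegreeBelow d f → DegreeBelow d g
degreeBelow-cong zero    f≗g f-deg m = trans (sym (f≗g m)) (f-deg m)
degreeBelow-cong (suc d) f≗g f-deg   = degreeBelow-cong d (λ m → cong₂ _-_ (f≗g (suc m)) (f≗g m)) f-deg

degreeBelow-+ : ∀ d {f g} → DegreeBelow d f → DegreeBelow d g → DegreeBelow d (λ m → f m + g m)
degreeBelow-+ zero    f-deg g-deg m = cong₂ _+_ (f-deg m) (g-deg m)
degreeBelow-+ (suc d) {f} {g} f-deg g-deg = degreeBelow-cong d
  (λ m → solve 4 (λ a b c e → a :- b :+ (c :- e) := a :+ c :- (b :+ e)) refl (f (suc m)) (f m) (g (suc m)) (g m))
  (degreeBelow-+ d f-deg g-deg)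

degreeBelow-suc : ∀ d {f} → DegreeBelow d f → DegreeBelow (suc d) f
degreeBelow-suc zero    f-deg m = cong₂ _-_ (f-deg (suc m)) (f-deg m)
degreeBelow-suc (suc d) f-deg   = degreeBelow-suc d f-deg

degreeBelow-weaken : ∀ {d e f} → d ℕ.≤ e → DegreeBelow d f → DegreeBelow e f
degreeBelow-weaken {zero}  {zero}  d≤e f-deg = f-deg
degreeBelow-weaken {zero}  {suc e} {f} d≤e f-deg = degreeBelow-suc e {f} (degreeBelow-weaken {zero} {e} {f} ℕ.z≤n f-deg)
degreeBelow-weaken {suc d} {suc e} {f} (ℕ.s≤s d≤e) f-deg = degreeBelow-weaken {d} {e} {Δ f} d≤e f-deg

degreeBelow-shift : ∀ d {f} → DegreeBelow d f → DegreeBelow d (λ m → f (suc m))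
degreeBelow-shift zero    f-deg m = f-deg (suc m)
degreeBelow-shift (suc d) f-deg   = degreeBelow-shift d f-deg

-- Leibniz rule: the linear factor has difference 1, so the difference of the product at m is
-- `Δ f m * (m + a) + f (m + 1)`, and both terms have degree below d.
degreeBelow-*-linear : ∀ d {f} a → DegreeBelow d f → DegreeBelow (suc d) (λ m → f m * (ℕ→ℚ m + a))
degreeBelow-*-linear zero {f} a f-deg m = trans (cong₂ _-_ (vanish (suc m)) (vanish m)) refl
  where
  vanish : ∀ i → f i * (ℕ→ℚ i + a) ≡ 0ℚ
  vanish i = trans (cong (_* (ℕ→ℚ i + a)) (f-deg i)) (*-zeroˡ (ℕ→ℚ i + a))
degreeBelow-*-linear (suc d) {f} a f-deg = degreeBelow-cong (suc d) {λ m → Δ f m * (ℕ→ℚ m + a) + f (suc m)} leibniz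
  (degreeBelow-+ (suc d) {λ m → Δ f m * (ℕ→ℚ m + a)} {λ m → f (suc m)}
    (degreeBelow-*-linear d {Δ f} a f-deg) (degreeBelow-shift (suc d) {f} f-deg))
  where
  leibniz : ∀ m → Δ f m * (ℕ→ℚ m + a) + f (suc m) ≡ f (suc m) * (ℕ→ℚ (suc m) + a) - f m * (ℕ→ℚ m + a)
  leibniz m = trans
    (solve 4 (λ g f m a → (g :- f) :* (m :+ a) :+ g := g :* (con 1ℚ :+ m :+ a) :- f :* (m :+ a)) refl (f (suc m)) (f m) (ℕ→ℚ m) a)
    (cong (λ t → f (suc m) * (t + a) - f m * (ℕ→ℚ m + a)) (sym (ℕ→ℚ-suc m)))

degreeBelow-*-pow : ∀ d {f} a k → DegreeBelow d f → DegreeBelow (k ℕ.+ d) (λ m → f m * pow (ℕ→ℚ m + a) k)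
degreeBelow-*-pow d {f} a zero    f-deg = degreeBelow-cong d (λ m → sym (*-identityʳ (f m))) f-deg
degreeBelow-*-pow d {f} a (suc k) f-deg = degreeBelow-cong (suc k ℕ.+ d)
  (λ m → *-assoc (f m) (pow (ℕ→ℚ m + a) k) (ℕ→ℚ m + a))
  (degreeBelow-*-linear (k ℕ.+ d) {λ m → f m * pow (ℕ→ℚ m + a) k} a (degreeBelow-*-pow d {f} a k f-deg))

-- signedBinomial N m = (-1)ᵐ · (N choose m)
signedBinomial : ℕ → ℕ → ℚ
signedBinomial zero    zero    = 1ℚ
signedBinomial zero    (suc m) = 0ℚ
signedBinomial (suc N) zero    = 1ℚ
signedBinomial (suc N) (suc m) = signedBinomial N (suc m) - signedBinomial N m

signedBinomial-0 : ∀ N → signedBinomial N 0 ≡ 1ℚ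
signedBinomial-0 zero    = refl
signedBinomial-0 (suc N) = refl

signedBinomial-> : ∀ N k → signedBinomial N (suc (N ℕ.+ k)) ≡ 0ℚ
signedBinomial-> zero    k = refl
signedBinomial-> (suc N) k = cong₂ _-_
  (trans (cong (λ i → signedBinomial N (suc i)) (sym (ℕₚ.+-suc N k))) (signedBinomial-> N (suc k)))
  (signedBinomial-> N k)

-- The sum is, up to sign, the N-th difference of f at 0. Pascal's rule and summation by parts
-- reduce it to minus the same sum for N - 1 and `Δ f`.
signedBinomial-sum : ∀ N {f} → DegreeBelow N f → sumTo (suc N) (λ m → signedBinomial N m * f m) ≡ 0ℚ
signedBinomial-sum zero    {f} f-deg = cong (λ t → 0ℚ + 1ℚ * t) (f-deg 0)
signedBinomial-sum (suc N) {f} f-deg = begin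
  sumTo (suc (suc N)) (λ m → signedBinomial (suc N) m * f m)
    ≡⟨ sumTo-shift (suc N) (λ m → signedBinomial (suc N) m * f m) ⟩
  1ℚ * f 0 + sumTo (suc N) (λ m → (b (suc m) - b m) * f (suc m))
    ≡⟨ cong₂ (λ s t → s * f 0 + t) (sym (signedBinomial-0 N)) (trans (sumTo-cong (suc N) (λ m _ → rearrange m)) (sym (sumTo-+ (suc N) _ _))) ⟩
  b 0 * f 0 + (sumTo (suc N) (λ m → b (suc m) * f (suc m)) + sumTo (suc N) (λ m → - 1ℚ * (b m * f (suc m))))
    ≡⟨ +-assoc (b 0 * f 0) _ _ ⟨
  b 0 * f 0 + sumTo (suc N) (λ m → b (suc m) * f (suc m)) + sumTo (suc N) (λ m → - 1ℚ * (b m * f (suc m)))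
    ≡⟨ cong (_+ sumTo (suc N) (λ m → - 1ℚ * (b m * f (suc m)))) (sumTo-shift (suc N) (λ m → b m * f m)) ⟨
  sumTo (suc N) (λ m → b m * f m) + b (suc N) * f (suc N) + sumTo (suc N) (λ m → - 1ℚ * (b m * f (suc m)))
    -- Undoing the shift creates a term with index N + 1, whose binomial coefficient is 0.
    ≡⟨ cong (λ t → sumTo (suc N) (λ m → b m * f m) + t + sumTo (suc N) (λ m → - 1ℚ * (b m * f (suc m)))) last≡0 ⟩
  sumTo (suc N) (λ m → b m * f m) + 0ℚ + sumTo (suc N) (λ m → - 1ℚ * (b m * f (suc m)))
    ≡⟨ cong (_+ sumTo (suc N) (λ m → - 1ℚ * (b m * f (suc m)))) (+-identityʳ (sumTo (suc N) (λ m → b m * f m))) ⟩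
  sumTo (suc N) (λ m → b m * f m) + sumTo (suc N) (λ m → - 1ℚ * (b m * f (suc m)))
    ≡⟨ sumTo-+ (suc N) _ _ ⟩
  sumTo (suc N) (λ m → b m * f m + - 1ℚ * (b m * f (suc m)))
    ≡⟨ sumTo-cong (suc N) (λ m _ → solve 3 (λ b f g → b :* f :+ con (- 1ℚ) :* (b :* g) := con (- 1ℚ) :* (b :* (g :- f))) refl (b m) (f m) (f (suc m))) ⟩
  sumTo (suc N) (λ m → - 1ℚ * (b m * Δ f m))
    ≡⟨ sumTo-* (suc N) (- 1ℚ) (λ m → b m * Δ f m) ⟨
  - 1ℚ * sumTo (suc N) (λ m → b m * Δ f m)
    ≡⟨ cong (- 1ℚ *_) (signedBinomial-sum N {Δ f} f-deg) ⟩
  0ℚ ∎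
  where
  open ≡-Reasoning
  b : ℕ → ℚ
  b = signedBinomial N
  rearrange : ∀ m → (b (suc m) - b m) * f (suc m) ≡ b (suc m) * f (suc m) + - 1ℚ * (b m * f (suc m))
  rearrange m = solve 3 (λ c b g → (c :- b) :* g := c :* g :+ con (- 1ℚ) :* (b :* g)) refl (b (suc m)) (b m) (f (suc m))
  last≡0 : b (suc N) * f (suc N) ≡ 0ℚ
  last≡0 = trans (cong (_* f (suc N)) (trans (cong (λ i → b (suc i)) (sym (ℕₚ.+-identityʳ N))) (signedBinomial-> N 0))) (*-zeroˡ (f (suc N)))

-- The absorption identity (m+1)(N choose m+1) = (N-m)(N choose m) with signs. By Pascal's rule the
-- left side at (N+1, m+1) is the difference of those at (N, m+1) and (N, m). Subtracting in ℚ keeps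
-- it true for m > N.
signedBinomial-absorb : ∀ N m →
  ℕ→ℚ (suc m) * signedBinomial N (suc m) + (ℕ→ℚ N - ℕ→ℚ m) * signedBinomial N m ≡ 0ℚ
signedBinomial-absorb zero    zero    = refl
signedBinomial-absorb zero    (suc m) =
  solve 2 (λ s t → s :* con 0ℚ :+ t :* con 0ℚ := con 0ℚ) refl (ℕ→ℚ (suc (suc m))) (ℕ→ℚ 0 - ℕ→ℚ (suc m))
signedBinomial-absorb (suc N) zero    = begin
  1ℚ * (b 1 - b 0) + (ℕ→ℚ (suc N) - 0ℚ) * 1ℚ
    ≡⟨ cong₂ (λ s t → 1ℚ * (b 1 - s) + (t - 0ℚ) * 1ℚ) (signedBinomial-0 N) (ℕ→ℚ-suc N) ⟩
  1ℚ * (b 1 - 1ℚ) + (1ℚ + ℕ→ℚ N - 0ℚ) * 1ℚ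
    ≡⟨ solve 2 (λ c n → con 1ℚ :* (c :- con 1ℚ) :+ (con 1ℚ :+ n :- con 0ℚ) :* con 1ℚ := con 1ℚ :* c :+ (n :- con 0ℚ) :* con 1ℚ) refl (b 1) (ℕ→ℚ N) ⟩
  1ℚ * b 1 + (ℕ→ℚ N - 0ℚ) * 1ℚ
    ≡⟨ cong (λ t → 1ℚ * b 1 + (ℕ→ℚ N - 0ℚ) * t) (signedBinomial-0 N) ⟨
  1ℚ * b 1 + (ℕ→ℚ N - 0ℚ) * b 0
    ≡⟨ signedBinomial-absorb N 0 ⟩
  0ℚ ∎
  where
  open ≡-Reasoning
  b : ℕ → ℚ
  b = signedBinomial N
signedBinomial-absorb (suc N) (suc m) = begin
  ℕ→ℚ (suc (suc m)) * (b (suc (suc m)) - b (suc m)) + (ℕ→ℚ (suc N) - ℕ→ℚ (suc m)) * (b (suc m) - b m)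
    ≡⟨ cong₂ (λ s t → s * (b (suc (suc m)) - b (suc m)) + (t - ℕ→ℚ (suc m)) * (b (suc m) - b m)) (ℕ→ℚ-suc (suc m)) (ℕ→ℚ-suc N) ⟩
  (1ℚ + ℕ→ℚ (suc m)) * (b (suc (suc m)) - b (suc m)) + (1ℚ + ℕ→ℚ N - ℕ→ℚ (suc m)) * (b (suc m) - b m)
    ≡⟨ cong (λ t → (1ℚ + t) * (b (suc (suc m)) - b (suc m)) + (1ℚ + ℕ→ℚ N - t) * (b (suc m) - b m)) (ℕ→ℚ-suc m) ⟩
  (1ℚ + (1ℚ + ℕ→ℚ m)) * (b (suc (suc m)) - b (suc m)) + (1ℚ + ℕ→ℚ N - (1ℚ + ℕ→ℚ m)) * (b (suc m) - b m)
    ≡⟨ solve 5 (λ c b a n m → (con 1ℚ :+ (con 1ℚ :+ m)) :* (c :- b) :+ (con 1ℚ :+ n :- (con 1ℚ :+ m)) :* (b :- a)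
         := ((con 1ℚ :+ (con 1ℚ :+ m)) :* c :+ (n :- (con 1ℚ :+ m)) :* b) :- ((con 1ℚ :+ m) :* b :+ (n :- m) :* a)) refl
         (b (suc (suc m))) (b (suc m)) (b m) (ℕ→ℚ N) (ℕ→ℚ m) ⟩
  ((1ℚ + (1ℚ + ℕ→ℚ m)) * b (suc (suc m)) + (ℕ→ℚ N - (1ℚ + ℕ→ℚ m)) * b (suc m)) - ((1ℚ + ℕ→ℚ m) * b (suc m) + (ℕ→ℚ N - ℕ→ℚ m) * b m)
    ≡⟨ cong (λ t → ((1ℚ + t) * b (suc (suc m)) + (ℕ→ℚ N - t) * b (suc m)) - (t * b (suc m) + (ℕ→ℚ N - ℕ→ℚ m) * b m)) (ℕ→ℚ-suc m) ⟨
  ((1ℚ + ℕ→ℚ (suc m)) * b (suc (suc m)) + (ℕ→ℚ N - ℕ→ℚ (suc m)) * b (suc m)) - (ℕ→ℚ (suc m) * b (suc m) + (ℕ→ℚ N - ℕ→ℚ m) * b m)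
    ≡⟨ cong (λ t → (t * b (suc (suc m)) + (ℕ→ℚ N - ℕ→ℚ (suc m)) * b (suc m)) - (ℕ→ℚ (suc m) * b (suc m) + (ℕ→ℚ N - ℕ→ℚ m) * b m)) (ℕ→ℚ-suc (suc m)) ⟨
  (ℕ→ℚ (suc (suc m)) * b (suc (suc m)) + (ℕ→ℚ N - ℕ→ℚ (suc m)) * b (suc m)) - (ℕ→ℚ (suc m) * b (suc m) + (ℕ→ℚ N - ℕ→ℚ m) * b m)
    ≡⟨ cong₂ _-_ (signedBinomial-absorb N (suc m)) (signedBinomial-absorb N m) ⟩
  0ℚ ∎
  where
  open ≡-Reasoning
  b : ℕ → ℚ
  b = signedBinomial N

-- The polynomials P and D, and congruences for p-integral rationals

poch-shift : ∀ x k → poch x (suc k) ≡ x * poch (1ℚ + x) k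
poch-shift x zero    = solve 1 (λ x → con 1ℚ :* (x :+ con 0ℚ) := x :* con 1ℚ) refl x
poch-shift x (suc k) = begin
  poch x (suc k) * (x + ℕ→ℚ (suc k))               ≡⟨ cong₂ (λ s t → s * (x + t)) (poch-shift x k) (ℕ→ℚ-suc k) ⟩
  x * poch (1ℚ + x) k * (x + (1ℚ + ℕ→ℚ k))         ≡⟨ solve 3 (λ x a k → x :* a :* (x :+ (con 1ℚ :+ k)) := x :* (a :* (con 1ℚ :+ x :+ k))) refl x (poch (1ℚ + x) k) (ℕ→ℚ k) ⟩
  x * (poch (1ℚ + x) k * (1ℚ + x + ℕ→ℚ k))         ∎
  where open ≡-Reasoning

u : ℕ → ℚ
u i = inv (ℕ→ℚ i)

H : ℕ → ℚ
H zero    = 0ℚ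
H (suc m) = H m + u (suc m) * u (suc m)

*-u : ∀ i → ℕ→ℚ (suc i) * u (suc i) ≡ 1ℚ
*-u i = *-inv (ℕ→ℚ (suc i)) (ℕ→ℚ-suc≢0 i)

-- k(k+1)/2, the coefficient of y² in (1 + y)^(-k), in the recursive form that `inverse-power`
-- produces.
triangular : ℕ → ℚ
triangular zero    = 0ℚ
triangular (suc k) = triangular k + ℕ→ℚ (suc k)

P : ℕ → ℕ → ℕ → ℚ
P n r m = pow (poch (ℕ→ℚ (suc m)) r) n

P-suc : ∀ n r m → P n (suc r) m ≡ P n r m * pow (ℕ→ℚ (suc m) + ℕ→ℚ r) n
P-suc n r m = pow-* (poch (ℕ→ℚ (suc m)) r) (ℕ→ℚ (suc m) + ℕ→ℚ r) n

-- Splits off the first factor where `P-suc` splits off the last; `P-reflect` and `F-above` play the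
-- two against each other.
P-shift : ∀ n r m → P n (suc r) m ≡ pow (ℕ→ℚ (suc m)) n * P n r (suc m)
P-shift n r m = begin
  pow (poch (ℕ→ℚ (suc m)) (suc r)) n                             ≡⟨ cong (λ t → pow t n) (poch-shift (ℕ→ℚ (suc m)) r) ⟩
  pow (ℕ→ℚ (suc m) * poch (1ℚ + ℕ→ℚ (suc m)) r) n                ≡⟨ cong (λ t → pow (ℕ→ℚ (suc m) * poch t r) n) (ℕ→ℚ-suc (suc m)) ⟨
  pow (ℕ→ℚ (suc m) * poch (ℕ→ℚ (suc (suc m))) r) n               ≡⟨ pow-* (ℕ→ℚ (suc m)) (poch (ℕ→ℚ (suc (suc m))) r) n ⟩
  pow (ℕ→ℚ (suc m)) n * P n r (suc m)                            ∎
  where open ≡-Reasoning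

-- D n r m = P n r m * (H (r + m) - H m), presented as a polynomial in m.
D : ℕ → ℕ → ℕ → ℚ
D n zero    m = 0ℚ
D n (suc r) m = D n r m * pow (ℕ→ℚ (suc m) + ℕ→ℚ r) n + P n r m * pow (ℕ→ℚ (suc m) + ℕ→ℚ r) (n ∸ 2)

ℕ→ℚ-suc-+ : ∀ m r → ℕ→ℚ (suc m) + ℕ→ℚ r ≡ ℕ→ℚ (suc (r ℕ.+ m))
ℕ→ℚ-suc-+ m r = trans (sym (ℕ→ℚ-+ (suc m) r)) (cong (λ i → ℕ→ℚ (suc i)) (ℕₚ.+-comm m r))

-- Two of the n factors absorb the square of the reciprocal: this is what makes `D` a polynomial.
pow-∸2 : ∀ {n} → 2 ℕ.≤ n → ∀ z u → z * u ≡ 1ℚ → pow z n * (u * u) ≡ pow z (n ∸ 2)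
pow-∸2 {suc (suc k)} (ℕ.s≤s (ℕ.s≤s _)) z u zu≡1 = begin
  pow z k * z * z * (u * u)        ≡⟨ solve 3 (λ a z u → a :* z :* z :* (u :* u) := a :* (z :* u) :* (z :* u)) refl (pow z k) z u ⟩
  pow z k * (z * u) * (z * u)      ≡⟨ cong (λ t → pow z k * t * t) zu≡1 ⟩
  pow z k * 1ℚ * 1ℚ                ≡⟨ solve 1 (λ a → a :* con 1ℚ :* con 1ℚ := a) refl (pow z k) ⟩
  pow z k                          ∎
  where open ≡-Reasoning

-- Passing from r to r + 1 multiplies `P` by z^n and adds 1/z² to the difference of harmonic sums,
-- with z = m + 1 + r.
D≡P*ΔH : ∀ {n} → 2 ℕ.≤ n → ∀ r m → D n r m ≡ P n r m * (H (r ℕ.+ m) - H m)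
D≡P*ΔH {n} 2≤n zero    m = solve 2 (λ a h → con 0ℚ := a :* (h :- h)) refl (pow 1ℚ n) (H m)
D≡P*ΔH {n} 2≤n (suc r) m = begin
  D n r m * pow z n + P n r m * pow z (n ∸ 2)
    ≡⟨ cong₂ (λ s t → s * pow z n + P n r m * t) (D≡P*ΔH 2≤n r m) (sym (pow-∸2 2≤n z u′ zu≡1)) ⟩
  P n r m * (H (r ℕ.+ m) - H m) * pow z n + P n r m * (pow z n * (u′ * u′))
    ≡⟨ solve 5 (λ a h k z u → a :* (h :- k) :* z :+ a :* (z :* (u :* u)) := a :* z :* (h :+ u :* u :- k)) refl (P n r m) (H (r ℕ.+ m)) (H m) (pow z n) u′ ⟩
  P n r m * pow z n * (H (r ℕ.+ m) + u′ * u′ - H m)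
    ≡⟨ cong (_* (H (r ℕ.+ m) + u′ * u′ - H m)) (P-suc n r m) ⟨
  P n (suc r) m * (H (r ℕ.+ m) + u′ * u′ - H m) ∎
  where
  open ≡-Reasoning
  z u′ : ℚ
  z = ℕ→ℚ (suc m) + ℕ→ℚ r
  u′ = u (suc (r ℕ.+ m))
  zu≡1 : z * u′ ≡ 1ℚ
  zu≡1 = trans (cong (_* u′) (ℕ→ℚ-suc-+ m r)) (*-u (r ℕ.+ m))

linear-shift : ∀ m r → ℕ→ℚ m + (1ℚ + ℕ→ℚ r) ≡ ℕ→ℚ (suc m) + ℕ→ℚ r
linear-shift m r = trans (solve 2 (λ m r → m :+ (con 1ℚ :+ r) := con 1ℚ :+ m :+ r) refl (ℕ→ℚ m) (ℕ→ℚ r)) (cong (_+ ℕ→ℚ r) (sym (ℕ→ℚ-suc m)))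

P-degree : ∀ n r → DegreeBelow (suc (r ℕ.* n)) (P n r)
P-degree n zero    m = +-inverseʳ (pow 1ℚ n)
P-degree n (suc r) = subst (λ d → DegreeBelow d (P n (suc r))) (ℕₚ.+-suc n (r ℕ.* n))
  (degreeBelow-cong (n ℕ.+ suc (r ℕ.* n))
    (λ m → trans (cong (λ t → P n r m * pow t n) (linear-shift m r)) (sym (P-suc n r m)))
    (degreeBelow-*-pow (suc (r ℕ.* n)) {P n r} (1ℚ + ℕ→ℚ r) n (P-degree n r)))

-- The bound for `P` is reused: the summand with exponent n - 2 is weakened to it, so one hypothesis
-- on p serves both polynomials.
D-degree : ∀ n r → DegreeBelow (suc (r ℕ.* n)) (D n r)
D-degree n zero    m = refl
D-degree n (suc r) = subst (λ d → DegreeBelow d (D n (suc r))) (ℕₚ.+-suc n (r ℕ.* n))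
  (degreeBelow-cong (n ℕ.+ suc (r ℕ.* n))
    (λ m → cong (λ t → D n r m * pow t n + P n r m * pow t (n ∸ 2)) (linear-shift m r))
    (degreeBelow-+ (n ℕ.+ suc (r ℕ.* n)) {λ m → D n r m * pow (ℕ→ℚ m + a) n} {λ m → P n r m * pow (ℕ→ℚ m + a) (n ∸ 2)}
      (degreeBelow-*-pow (suc (r ℕ.* n)) {D n r} a n (D-degree n r))
      (degreeBelow-weaken {f = λ m → P n r m * pow (ℕ→ℚ m + a) (n ∸ 2)} (ℕₚ.+-monoˡ-≤ (suc (r ℕ.* n)) (ℕₚ.m∸n≤m n 2))
        (degreeBelow-*-pow (suc (r ℕ.* n)) {P n r} a (n ∸ 2) (P-degree n r)))))
  where
  a : ℚ
  a = 1ℚ + ℕ→ℚ r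

-- Congruences modulo powers of p = N + 1.

module Estimates (N : ℕ) (p-prime : Prime (suc N)) where

  p : ℕ
  p = suc N

  π : ℚ
  π = ℕ→ℚ p

  open Localisation p p-prime public

  w : ℕ → ℚ
  w = signedBinomial N

  ideal-sumTo-+ : ∀ {j} m f g → Ideal p j (sumTo m f) → Ideal p j (sumTo m g) → Ideal p j (sumTo m (λ i → f i + g i))
  ideal-sumTo-+ {j} m f g f-id g-id = subst (Ideal p j) (sumTo-+ m f g) (ideal-+ f-id g-id)

  ideal-sumTo-* : ∀ {j} m c f → Integral p c → Ideal p j (sumTo m f) → Ideal p j (sumTo m (λ i → c * f i))
  ideal-sumTo-* {j} m c f c-int f-id = subst (Ideal p j) (sumTo-* m c f) (ideal-*ˡ c-int f-id)

  ideal-pow-cong : ∀ {j x y} k → Integral p x → Integral p y → Ideal p j (x - y) → Ideal p j (pow x k - pow y k)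
  ideal-pow-cong zero x-int y-int x-y = ideal-0
  ideal-pow-cong {j} {x} {y} (suc k) x-int y-int x-y = subst (Ideal p j)
    (solve 4 (λ a b x y → (a :- b) :* x :+ b :* (x :- y) := a :* x :- b :* y) refl (pow x k) (pow y k) x y)
    (ideal-+ (ideal-*ʳ (ideal-pow-cong k x-int y-int x-y) x-int) (ideal-*ˡ (integral-pow k y-int) x-y))

  p∤suc : ∀ {i} → suc i < p → ¬ (p ∣ suc i)
  p∤suc = >⇒∤

  integral-u : ∀ i → suc i < p → Integral p (u (suc i))
  integral-u i i<p = integral-inv (ℕ→ℚ (suc i)) (+ 1) (+ suc i) (p∤suc i<p) (*-identityʳ (ℕ→ℚ (suc i)))

  integral-H : ∀ m → m < p → Integral p (H m)
  integral-H zero    _   = integral-ℕ 0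
  integral-H (suc m) m<p = integral-+ (integral-H m (ℕₚ.<⇒≤ m<p)) (integral-* (integral-u m m<p) (integral-u m m<p))

  integral-signedBinomial : ∀ M m → Integral p (signedBinomial M m)
  integral-signedBinomial zero    zero    = integral-ℕ 1
  integral-signedBinomial zero    (suc m) = integral-ℕ 0
  integral-signedBinomial (suc M) zero    = integral-ℕ 1
  integral-signedBinomial (suc M) (suc m) =
    integral-+ (integral-signedBinomial M (suc m)) (integral-neg (integral-signedBinomial M m))

  -- Absorption with N - m = p - (m + 1), divided by m + 1.
  w-suc : ∀ m → w (suc m) ≡ w m * (1ℚ - π * u (suc m))
  w-suc m = begin
    w (suc m)
      ≡⟨ *-identityˡ (w (suc m)) ⟨
    1ℚ * w (suc m)
      ≡⟨ cong (_* w (suc m)) (*-u m) ⟨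
    ℕ→ℚ (suc m) * u′ * w (suc m)
      ≡⟨ solve 5 (λ s u w′ k w → s :* u :* w′ := u :* (s :* w′ :+ k :* w) :- u :* k :* w) refl (ℕ→ℚ (suc m)) u′ (w (suc m)) (ℕ→ℚ N - ℕ→ℚ m) (w m) ⟩
    u′ * (ℕ→ℚ (suc m) * w (suc m) + (ℕ→ℚ N - ℕ→ℚ m) * w m) - u′ * (ℕ→ℚ N - ℕ→ℚ m) * w m
      ≡⟨ cong (λ t → u′ * t - u′ * (ℕ→ℚ N - ℕ→ℚ m) * w m) (signedBinomial-absorb N m) ⟩
    u′ * 0ℚ - u′ * (ℕ→ℚ N - ℕ→ℚ m) * w m
      ≡⟨ solve 4 (λ u n m w → u :* con 0ℚ :- u :* (n :- m) :* w := w :* ((con 1ℚ :+ m) :* u :- (con 1ℚ :+ n) :* u)) refl u′ (ℕ→ℚ N) (ℕ→ℚ m) (w m) ⟩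
    w m * ((1ℚ + ℕ→ℚ m) * u′ - (1ℚ + ℕ→ℚ N) * u′)
      ≡⟨ cong₂ (λ s t → w m * (s * u′ - t * u′)) (ℕ→ℚ-suc m) (ℕ→ℚ-suc N) ⟨
    w m * (ℕ→ℚ (suc m) * u′ - π * u′)
      ≡⟨ cong (λ t → w m * (t - π * u′)) (*-u m) ⟩
    w m * (1ℚ - π * u′) ∎
    where
    open ≡-Reasoning
    u′ : ℚ
    u′ = u (suc m)

  -- Each ratio 1 - p/(m+1) from `w-suc` is 1 modulo p as long as m + 1 < p.
  w≡1 : ∀ m → m < p → Ideal p 1 (w m - 1ℚ)
  w≡1 zero    _   = subst (λ t → Ideal p 1 (t - 1ℚ)) (sym (signedBinomial-0 N)) ideal-0
  w≡1 (suc m) m<p = subst (Ideal p 1)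
    (trans (solve 3 (λ w π u → w :- con 1ℚ :- π :* (w :* u) := w :* (con 1ℚ :- π :* u) :- con 1ℚ) refl (w m) π (u (suc m)))
      (cong (_- 1ℚ) (sym (w-suc m))))
    (ideal-- (w≡1 m (ℕₚ.<⇒≤ m<p)) (ideal-*ʳ ideal-p (integral-* (integral-signedBinomial N m) (integral-u m m<p))))

  -- Modulo p the weight 1 may be replaced by `w m`, and the weighted sum is a (p-1)-st difference,
  -- which vanishes exactly.
  sum-polynomial≡0 : ∀ {f} → DegreeBelow N f → (∀ m → Integral p (f m)) → Ideal p 1 (sumTo p f)
  sum-polynomial≡0 {f} f-deg f-int = subst (Ideal p 1)
    (sumTo-cong p (λ m _ → solve 2 (λ w f → w :* f :+ :- ((w :- con 1ℚ) :* f) := f) refl (w m) (f m)))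
    (ideal-sumTo-+ p (λ m → w m * f m) (λ m → - ((w m - 1ℚ) * f m))
      (subst (Ideal p 1) (sym (signedBinomial-sum N f-deg)) ideal-0)
      (ideal-sumTo p (λ m m<p → ideal-neg (ideal-*ʳ (w≡1 m m<p) (f-int m)))))

  integral-triangular : ∀ k → Integral p (triangular k)
  integral-triangular zero    = integral-ℕ 0
  integral-triangular (suc k) = integral-+ (integral-triangular k) (integral-ℕ (suc k))

  -- Taylor expansion of (1 + y)^(-k) with g = 1/(1 + y). One more factor g adds only the error -(T
  -- + k + 1) g y³, which lies in the cube of the ideal.
  inverse-power : ∀ {y g} → Ideal p 1 y → Integral p g → g * (1ℚ + y) ≡ 1ℚ →
    ∀ k → Ideal p 3 (pow g k - (1ℚ - ℕ→ℚ k * y + triangular k * (y * y)))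
  inverse-power {y} {g} y-id g-int g≡ zero = subst (Ideal p 3)
    (solve 1 (λ y → con 0ℚ := con 1ℚ :- (con 1ℚ :- con 0ℚ :* y :+ con 0ℚ :* (y :* y))) refl y) ideal-0
  inverse-power {y} {g} y-id g-int g≡ (suc k) = subst (Ideal p 3) expand
    (ideal-- (ideal-*ʳ (inverse-power y-id g-int g≡ k) g-int)
      (ideal-*ˡ (integral-* (integral-+ (integral-triangular k) (integral-ℕ (suc k))) g-int) (ideal-* y-id (ideal-* y-id y-id))))
    where
    open ≡-Reasoning
    G K T : ℚ
    G = pow g k
    K = ℕ→ℚ k
    T = triangular k
    expand : (G - (1ℚ - K * y + T * (y * y))) * g - (T + ℕ→ℚ (suc k)) * g * (y * (y * y))
      ≡ G * g - (1ℚ - ℕ→ℚ (suc k) * y + (T + ℕ→ℚ (suc k)) * (y * y))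
    expand = begin
      (G - (1ℚ - K * y + T * (y * y))) * g - (T + ℕ→ℚ (suc k)) * g * (y * (y * y))
        ≡⟨ cong (λ s → (G - (1ℚ - K * y + T * (y * y))) * g - (T + s) * g * (y * (y * y))) (ℕ→ℚ-suc k) ⟩
      (G - (1ℚ - K * y + T * (y * y))) * g - (T + (1ℚ + K)) * g * (y * (y * y))
        ≡⟨ solve 5 (λ G K y T g → (G :- (con 1ℚ :- K :* y :+ T :* (y :* y))) :* g :- (T :+ (con 1ℚ :+ K)) :* g :* (y :* (y :* y))
             := G :* g :- (con 1ℚ :- (con 1ℚ :+ K) :* y :+ (T :+ (con 1ℚ :+ K)) :* (y :* y)) :* (g :* (con 1ℚ :+ y))) refl G K y T g ⟩
      G * g - (1ℚ - (1ℚ + K) * y + (T + (1ℚ + K)) * (y * y)) * (g * (1ℚ + y))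
        ≡⟨ cong₂ (λ s t → G * g - (1ℚ - s * y + (T + s) * (y * y)) * t) (sym (ℕ→ℚ-suc k)) g≡ ⟩
      G * g - (1ℚ - ℕ→ℚ (suc k) * y + (T + ℕ→ℚ (suc k)) * (y * y)) * 1ℚ
        ≡⟨ cong (λ t → G * g - t) (*-identityʳ (1ℚ - ℕ→ℚ (suc k) * y + (T + ℕ→ℚ (suc k)) * (y * y))) ⟩
      G * g - (1ℚ - ℕ→ℚ (suc k) * y + (T + ℕ→ℚ (suc k)) * (y * y)) ∎

  integral-poch : ∀ {x} k → Integral p x → Integral p (poch x k)
  integral-poch zero    x-int = integral-ℕ 1
  integral-poch (suc k) x-int = integral-* (integral-poch k x-int) (integral-+ x-int (integral-ℕ k))

  integral-P : ∀ n r m → Integral p (P n r m)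
  integral-P n r m = integral-pow n (integral-poch r (integral-ℕ (suc m)))

  integral-D : ∀ n r m → Integral p (D n r m)
  integral-D n zero    m = integral-ℕ 0
  integral-D n (suc r) m = integral-+
    (integral-* (integral-D n r m) (integral-pow n (integral-+ (integral-ℕ (suc m)) (integral-ℕ r))))
    (integral-* (integral-P n r m) (integral-pow (n ∸ 2) (integral-+ (integral-ℕ (suc m)) (integral-ℕ r))))

  -- One of the factors m+1, ..., m+r is p itself; the induction walks down to it.
  P-tail : ∀ n r m → m < p → p ℕ.≤ r ℕ.+ m → Ideal p n (P n r m)
  P-tail n zero    m m<p p≤m   = contradiction p≤m (ℕₚ.<⇒≱ m<p)
  P-tail n (suc r) m m<p p≤r+m with ℕₚ.m≤n⇒m<n∨m≡n p≤r+m
  ... | inj₁ (ℕ.s≤s p≤r+m′) = subst (Ideal p n) (sym (P-suc n r m))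
    (ideal-*ʳ (P-tail n r m m<p p≤r+m′) (integral-pow n (integral-+ (integral-ℕ (suc m)) (integral-ℕ r))))
  ... | inj₂ p≡ = subst (Ideal p n) (sym (P-suc n r m))
    (ideal-*ˡ (integral-P n r m) (subst (λ t → Ideal p n (pow t n)) (trans (cong ℕ→ℚ p≡) (sym (ℕ→ℚ-suc-+ m r))) (ideal-pow n)))

  D-tail : ∀ {n} → 2 < n → ∀ r m → m < p → p ℕ.≤ r ℕ.+ m → Ideal p 1 (D n r m)
  D-tail {n} 2<n zero    m m<p p≤m   = contradiction p≤m (ℕₚ.<⇒≱ m<p)
  D-tail {n} 2<n (suc r) m m<p p≤r+m with ℕₚ.m≤n⇒m<n∨m≡n p≤r+m
  ... | inj₁ (ℕ.s≤s p≤r+m′) = ideal-+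
    (ideal-*ʳ (D-tail 2<n r m m<p p≤r+m′) (integral-pow n (integral-+ (integral-ℕ (suc m)) (integral-ℕ r))))
    (ideal-*ʳ (ideal-weaken (ℕₚ.<-trans (ℕ.s≤s ℕ.z≤n) 2<n) (P-tail n r m m<p p≤r+m′)) (integral-pow (n ∸ 2) (integral-+ (integral-ℕ (suc m)) (integral-ℕ r))))
  ... | inj₂ p≡ = ideal-+
    (ideal-*ˡ (integral-D n r m) (power n (ℕₚ.<-trans (ℕ.s≤s ℕ.z≤n) 2<n)))
    -- When the new factor is p, this summand gains only p^(n-2); hence n > 2.
    (ideal-*ˡ (integral-P n r m) (power (n ∸ 2) (ℕₚ.m<n⇒0<n∸m 2<n)))
    where
    power : ∀ k → 0 < k → Ideal p 1 (pow (ℕ→ℚ (suc m) + ℕ→ℚ r) k)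
    power k 0<k = subst (λ t → Ideal p 1 (pow t k)) (trans (cong ℕ→ℚ p≡) (sym (ℕ→ℚ-suc-+ m r))) (ideal-weaken 0<k (ideal-pow k))

  -- Factors pair up to p: the last one at `a` is minus the first one at `b` modulo p. Splitting off
  -- such a pair replaces b by b + 1 and contributes the sign (-1)^n.
  P-reflect : ∀ n r a b → suc (a ℕ.+ b ℕ.+ r) ≡ p → Ideal p 1 (P n r a - pow (pow (- 1ℚ) n) r * P n r b)
  P-reflect n zero    a b _  = subst (Ideal p 1) (solve 1 (λ x → con 0ℚ := x :- con 1ℚ :* x) refl (pow 1ℚ n)) ideal-0
  P-reflect n (suc r) a b a+b+r = subst (Ideal p 1) expand
    (ideal-+ (ideal-*ʳ (P-reflect n r a (suc b) a+b+r′) (integral-pow n X-int))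
      (ideal-*ˡ (integral-* ε-int (integral-P n r (suc b))) (ideal-pow-cong n X-int -Y-int X+Y)))
    where
    open ≡-Reasoning
    X Y ε : ℚ
    X = ℕ→ℚ (suc a) + ℕ→ℚ r
    Y = ℕ→ℚ (suc b)
    ε = pow (- 1ℚ) n
    a+b+r′ : suc (a ℕ.+ suc b ℕ.+ r) ≡ p
    a+b+r′ = trans (cong suc (trans (cong (ℕ._+ r) (ℕₚ.+-suc a b)) (sym (ℕₚ.+-suc (a ℕ.+ b) r)))) a+b+r
    X-int : Integral p X
    X-int = integral-+ (integral-ℕ (suc a)) (integral-ℕ r)
    -Y-int : Integral p (- 1ℚ * Y)
    -Y-int = integral-* (integral-ℤ -[1+ 0 ]) (integral-ℕ (suc b))
    ε-int : Integral p (pow ε r)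
    ε-int = integral-pow r (integral-pow n (integral-ℤ -[1+ 0 ]))
    X+Y : Ideal p 1 (X - - 1ℚ * Y)
    X+Y = subst (Ideal p 1) (begin
      π                                                  ≡⟨ cong ℕ→ℚ a+b+r′ ⟨
      ℕ→ℚ (suc a ℕ.+ suc b ℕ.+ r)                        ≡⟨ ℕ→ℚ-+ (suc a ℕ.+ suc b) r ⟩
      ℕ→ℚ (suc a ℕ.+ suc b) + ℕ→ℚ r                      ≡⟨ cong (_+ ℕ→ℚ r) (ℕ→ℚ-+ (suc a) (suc b)) ⟩
      ℕ→ℚ (suc a) + Y + ℕ→ℚ r                            ≡⟨ solve 3 (λ a y r → a :+ y :+ r := a :+ r :- con (- 1ℚ) :* y) refl (ℕ→ℚ (suc a)) Y (ℕ→ℚ r) ⟩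
      X - - 1ℚ * Y                                       ∎) ideal-p
    expand : (P n r a - pow ε r * P n r (suc b)) * pow X n + pow ε r * P n r (suc b) * (pow X n - pow (- 1ℚ * Y) n)
      ≡ P n (suc r) a - pow ε (suc r) * P n (suc r) b
    expand = begin
      (P n r a - pow ε r * P n r (suc b)) * pow X n + pow ε r * P n r (suc b) * (pow X n - pow (- 1ℚ * Y) n)
        ≡⟨ cong (λ t → (P n r a - pow ε r * P n r (suc b)) * pow X n + pow ε r * P n r (suc b) * (pow X n - t)) (pow-* (- 1ℚ) Y n) ⟩
      (P n r a - pow ε r * P n r (suc b)) * pow X n + pow ε r * P n r (suc b) * (pow X n - ε * pow Y n)
        ≡⟨ solve 6 (λ A E B x e y → (A :- E :* B) :* x :+ E :* B :* (x :- e :* y) := A :* x :- E :* e :* (y :* B)) refl (P n r a) (pow ε r) (P n r (suc b)) (pow X n) ε (pow Y n) ⟩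
      P n r a * pow X n - pow ε r * ε * (pow Y n * P n r (suc b))
        ≡⟨ cong₂ (λ s t → s - pow ε r * ε * t) (P-suc n r a) (P-shift n r b) ⟨
      P n (suc r) a - pow ε (suc r) * P n (suc r) b ∎

  -- Moving one term from `H b` to `H a` trades t² for s², where t = 1/(b+1) and s = 1/(a+1). The
  -- two denominators add up to p, so t + s = p s t and t² - s² vanishes modulo p.
  H-reflect : ∀ a b → a ℕ.+ b ≡ N → Ideal p 1 (H a + H b - H N)
  H-reflect a zero    a+0≡N = subst (Ideal p 1)
    (trans (solve 1 (λ h → con 0ℚ := h :+ con 0ℚ :- h) refl (H a)) (cong (λ i → H a + 0ℚ - H i) (trans (sym (ℕₚ.+-identityʳ a)) a+0≡N))) ideal-0
  H-reflect a (suc b) a+b≡N = subst (Ideal p 1)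
    (solve 5 (λ A B C s t → A :+ s :* s :+ B :- C :+ (t :- s) :* (t :+ s) := A :+ (B :+ t :* t) :- C) refl (H a) (H b) (H N) s t)
    (ideal-+ (H-reflect (suc a) b (trans (sym (ℕₚ.+-suc a b)) a+b≡N))
      (ideal-*ˡ (integral-+ t-int (integral-neg s-int)) t+s))
    where
    open ≡-Reasoning
    s t : ℚ
    s = u (suc a)
    t = u (suc b)
    s-int : Integral p s
    s-int = integral-u a (ℕ.s≤s (subst (suc a ℕ.≤_) (trans (sym (ℕₚ.+-suc a b)) a+b≡N) (ℕₚ.m≤m+n (suc a) b)))
    t-int : Integral p t
    t-int = integral-u b (ℕ.s≤s (subst (suc b ℕ.≤_) a+b≡N (ℕₚ.m≤n+m (suc b) a)))
    t+s : Ideal p 1 (t + s)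
    t+s = subst (Ideal p 1) (begin
      π * (s * t)                                             ≡⟨ cong (λ i → ℕ→ℚ (suc i) * (s * t)) a+b≡N ⟨
      ℕ→ℚ (suc a ℕ.+ suc b) * (s * t)                         ≡⟨ cong (_* (s * t)) (ℕ→ℚ-+ (suc a) (suc b)) ⟩
      (ℕ→ℚ (suc a) + ℕ→ℚ (suc b)) * (s * t)                   ≡⟨ solve 4 (λ a b s t → (a :+ b) :* (s :* t) := (a :* s) :* t :+ (b :* t) :* s) refl (ℕ→ℚ (suc a)) (ℕ→ℚ (suc b)) s t ⟩
      ℕ→ℚ (suc a) * s * t + ℕ→ℚ (suc b) * t * s               ≡⟨ cong₂ (λ i j → i * t + j * s) (*-u a) (*-u b) ⟩
      1ℚ * t + 1ℚ * s                                         ≡⟨ cong₂ _+_ (*-identityˡ t) (*-identityˡ s) ⟩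
      t + s                                                   ∎) (ideal-*ʳ ideal-p (integral-* s-int t-int))

-- The sign (-1)^(rn).

pow-even : ∀ x → x * x ≡ 1ℚ → ∀ {k} → 2 ∣ k → pow x k ≡ 1ℚ
pow-even x xx≡1 (divides j refl) = go j
  where
  go : ∀ j → pow x (j ℕ.* 2) ≡ 1ℚ
  go zero    = refl
  go (suc j) = trans (*-assoc (pow x (j ℕ.* 2)) x x) (cong₂ _*_ (go j) xx≡1)

even-or-odd : ∀ k → (2 ∣ k) ⊎ (2 ∣ suc k)
even-or-odd zero    = inj₁ (divides 0 refl)
even-or-odd (suc k) with even-or-odd k
... | inj₁ (divides j refl) = inj₂ (divides (suc j) refl)
... | inj₂ 2∣1+k            = inj₁ 2∣1+k

-- For n even the inner power is 1; for q = r + 1 odd, r is even and the inner power squares to 1.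
sign≡1 : ∀ {n r} → 2 ∣ n ⊎ ¬ (2 ∣ suc r) → pow (pow (- 1ℚ) n) r ≡ 1ℚ
sign≡1 {n} {r} (inj₁ 2∣n) = trans (cong (λ t → pow t r) (pow-even (- 1ℚ) refl 2∣n)) (pow-1 r)
sign≡1 {n} {r} (inj₂ 2∤1+r) with even-or-odd r
... | inj₁ 2∣r   = pow-even (pow (- 1ℚ) n) (trans (sym (pow-* (- 1ℚ) (- 1ℚ) n)) (pow-1 n)) 2∣r
... | inj₂ 2∣1+r = contradiction 2∣1+r 2∤1+r

*-<⇒≤ : ∀ m {n o} → 0 < n → m ℕ.* n < o → m ℕ.≤ o
*-<⇒≤ m 0<n mn<o = ℕₚ.≤-trans (ℕₚ.≤-reflexive (sym (ℕₚ.*-identityʳ m))) (ℕₚ.≤-trans (ℕₚ.*-monoʳ-≤ m 0<n) (ℕₚ.<⇒≤ mn<o))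

-- Sums over the L = p - r terms with k = r + m.

module Series (N : ℕ) (p-prime : Prime (suc N)) (n r L : ℕ) (2<n : 2 < n) (n<p : n < suc N)
  (parity : 2 ∣ n ⊎ ¬ (2 ∣ suc r)) (rn<N : suc (r ℕ.* n) ℕ.≤ N) (L+r≡p : L ℕ.+ r ≡ suc N) where

  open Estimates N p-prime public

  2≤n : 2 ℕ.≤ n
  2≤n = ℕₚ.<⇒≤ 2<n

  tail< : ∀ {i} → i < r → L ℕ.+ i < p
  tail< {i} i<r = subst (L ℕ.+ i <_) L+r≡p (ℕₚ.+-monoʳ-< L i<r)

  tail≥ : ∀ i → p ℕ.≤ r ℕ.+ (L ℕ.+ i)
  tail≥ i = subst (ℕ._≤ r ℕ.+ (L ℕ.+ i)) (trans (ℕₚ.+-comm r L) L+r≡p) (ℕₚ.+-monoʳ-≤ r (ℕₚ.m≤m+n L i))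

  <L⇒<p : ∀ {m} → m < L → m < p
  <L⇒<p m<L = ℕₚ.≤-trans m<L (subst (L ℕ.≤_) L+r≡p (ℕₚ.m≤m+n L r))

  -- Difference arguments need all p indices, while the series supplies only m < L. The r extra
  -- values, where `P` contains the factor p, are subtracted again.
  truncate : ∀ {j} f → (∀ i → i < r → Ideal p j (f (L ℕ.+ i))) → Ideal p j (sumTo p f) → Ideal p j (sumTo L f)
  truncate {j} f tail total = subst (Ideal p j)
    (trans (cong (λ k → sumTo k f - sumTo r (λ i → f (L ℕ.+ i))) (sym L+r≡p))
      (trans (cong (_- sumTo r (λ i → f (L ℕ.+ i))) (sumTo-split L r f))
        (solve 2 (λ a b → a :+ b :- b := a) refl (sumTo L f) (sumTo r (λ i → f (L ℕ.+ i))))))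
    (ideal-- total (ideal-sumTo r tail))

  sum-P≡0 : Ideal p 1 (sumTo L (P n r))
  sum-P≡0 = truncate (P n r)
    (λ i i<r → ideal-weaken (ℕₚ.<-trans (ℕ.s≤s ℕ.z≤n) 2<n) (P-tail n r (L ℕ.+ i) (tail< i<r) (tail≥ i)))
    (sum-polynomial≡0 (degreeBelow-weaken {f = P n r} rn<N (P-degree n r)) (integral-P n r))

  sum-D≡0 : Ideal p 1 (sumTo L (D n r))
  sum-D≡0 = truncate (D n r)
    (λ i i<r → D-tail 2<n r (L ℕ.+ i) (tail< i<r) (tail≥ i))
    (sum-polynomial≡0 (degreeBelow-weaken {f = D n r} rn<N (D-degree n r)) (integral-D n r))

  -- Over all p indices the sum is exactly 0 by the degree bound; the tail lies in p^n, and n > 2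
  -- gives p³.
  sum-wP≡0 : Ideal p 3 (sumTo L (λ m → w m * P n r m))
  sum-wP≡0 = truncate (λ m → w m * P n r m)
    (λ i i<r → ideal-*ˡ (integral-signedBinomial N (L ℕ.+ i)) (ideal-weaken 2<n (P-tail n r (L ℕ.+ i) (tail< i<r) (tail≥ i))))
    (subst (Ideal p 3) (sym (signedBinomial-sum N (degreeBelow-weaken {f = P n r} rn<N (P-degree n r)))) ideal-0)

  sum-PH≡0 : Ideal p 1 (sumTo L (λ m → P n r m * H m))
  -- Only twice the sum is accessible by reflection; 2 < n < p makes 1/2 integral at p.
  sum-PH≡0 = subst (Ideal p 1) halve (ideal-*ˡ (integral-u 1 (ℕₚ.<-trans 2<n n<p)) twice)
    where
    open ≡-Reasoning
    S : ℚ
    S = sumTo L (λ m → P n r m * H m)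
    a : ℕ → ℕ
    a i = L ∸ suc i
    halve : u 2 * (S + S) ≡ S
    halve = begin
      u 2 * (S + S)                ≡⟨ solve 2 (λ h s → h :* (s :+ s) := con (ℕ→ℚ 2) :* h :* s) refl (u 2) S ⟩
      ℕ→ℚ 2 * u 2 * S              ≡⟨ cong (_* S) (*-u 1) ⟩
      1ℚ * S                       ≡⟨ *-identityˡ S ⟩
      S                            ∎
    -- With a + (r + i) = p - 1, the two reflections give Pa Ha ≡ Pb (H(p-1) - Hr). Inserting `H i`
    -- isolates `D`; the constant H(p-1) only multiplies `sum-P≡0`.
    reflected : ∀ i → i < L → Ideal p 1 (P n r (a i) * H (a i) + (P n r i * H i + (D n r i + - H N * P n r i)))
    reflected i i<L = subst (Ideal p 1) (begin
      (Pa - E * Pb) * Ha + Pb * (Ha + Hr - H N)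
        ≡⟨ cong (λ t → (Pa - t * Pb) * Ha + Pb * (Ha + Hr - H N)) (sign≡1 parity) ⟩
      (Pa - 1ℚ * Pb) * Ha + Pb * (Ha + Hr - H N)
        ≡⟨ solve 6 (λ Pa Pb Ha Hb Hr HN → (Pa :- con 1ℚ :* Pb) :* Ha :+ Pb :* (Ha :+ Hr :- HN)
             := Pa :* Ha :+ (Pb :* Hb :+ (Pb :* (Hr :- Hb) :+ :- HN :* Pb))) refl Pa Pb Ha (H i) Hr (H N) ⟩
      Pa * Ha + (Pb * H i + (Pb * (Hr - H i) + - H N * Pb))
        ≡⟨ cong (λ t → Pa * Ha + (Pb * H i + (t + - H N * Pb))) (D≡P*ΔH 2≤n r i) ⟨
      Pa * Ha + (Pb * H i + (D n r i + - H N * Pb)) ∎)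
      (ideal-+ (ideal-*ʳ (P-reflect n r (a i) i sum≡p) (integral-H (a i) a<p))
        (ideal-*ˡ (integral-P n r i) (H-reflect (a i) (r ℕ.+ i) sum≡N)))
      where
      Pa Pb Ha Hr E : ℚ
      Pa = P n r (a i)
      Pb = P n r i
      Ha = H (a i)
      Hr = H (r ℕ.+ i)
      E = pow (pow (- 1ℚ) n) r
      sum≡p : suc (a i ℕ.+ i ℕ.+ r) ≡ p
      sum≡p = trans (cong (ℕ._+ r) (trans (sym (ℕₚ.+-suc (a i) i)) (ℕₚ.m∸n+n≡m i<L))) L+r≡p
      sum≡N : a i ℕ.+ (r ℕ.+ i) ≡ N
      sum≡N = ℕₚ.suc-injective (trans (cong suc (trans (cong (a i ℕ.+_) (ℕₚ.+-comm r i)) (sym (ℕₚ.+-assoc (a i) i r)))) sum≡p)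
      a<p : a i < p
      a<p = ℕ.s≤s (subst (a i ℕ.≤_) sum≡N (ℕₚ.m≤m+n (a i) (r ℕ.+ i)))
    twice : Ideal p 1 (S + S)
    twice = subst (Ideal p 1) (begin
      sumTo L (λ i → P n r (a i) * H (a i) + (P n r i * H i + R i)) - sumTo L R
        ≡⟨ cong (_- sumTo L R) (trans (cong₂ _+_ (sumTo-reverse L (λ m → P n r m * H m)) (sumTo-+ L (λ i → P n r i * H i) R)) (sumTo-+ L _ _)) ⟨
      S + (S + sumTo L R) - sumTo L R
        ≡⟨ solve 2 (λ s t → s :+ (s :+ t) :- t := s :+ s) refl S (sumTo L R) ⟩
      S + S ∎)
      (ideal-- (ideal-sumTo L reflected) (ideal-sumTo-+ L (D n r) (λ i → - H N * P n r i) sum-D≡0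
        (ideal-sumTo-* L (- H N) (P n r) (integral-neg (integral-H N ℕₚ.≤-refl)) sum-P≡0)))
      where
      R : ℕ → ℚ
      R i = D n r i + - H N * P n r i

  -- Expansion of G modulo p³.

  v : ℚ
  v = u n

  n≢0 : ℕ→ℚ n ≢ 0ℚ
  n≢0 eq with ℤ→ℚ-injective (+ n) 0ℤ eq
  ... | refl = contradiction 2<n λ ()

  n*v≡1 : ℕ→ℚ n * v ≡ 1ℚ
  n*v≡1 = *-inv (ℕ→ℚ n) n≢0

  p∤n : ¬ (p ∣ n)
  p∤n p∣n = n≢0 (cong ℕ→ℚ (∣⇒0 p∣n))
    where
    ∣⇒0 : p ∣ n → n ≡ 0
    ∣⇒0 (divides zero    n≡) = n≡
    ∣⇒0 (divides (suc k) n≡) = contradiction n<p (ℕₚ.≤⇒≯ (subst (p ℕ.≤_) (sym n≡) (ℕₚ.m≤m+n p (k ℕ.* p))))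

  integral-v : Integral p v
  integral-v = integral-inv (ℕ→ℚ n) (+ 1) (+ n) p∤n (*-identityʳ (ℕ→ℚ n))

  -- The numerator of p/n + z over the denominator n. It is zn modulo p, hence prime to p whenever z
  -- is. Negative z serve the Pochhammer factors before p/n, positive z those after it.
  shifted-numerator : ℤ → ℤ
  shifted-numerator z = + p ℤ.+ z ℤ.* + n

  shifted-clears : ∀ z → (π * v + ℤ→ℚ z) * ℕ→ℚ n ≡ ℤ→ℚ (shifted-numerator z)
  shifted-clears z = begin
    (π * v + ℤ→ℚ z) * ℕ→ℚ n              ≡⟨ solve 4 (λ π v z n → (π :* v :+ z) :* n := π :* (n :* v) :+ z :* n) refl π v (ℤ→ℚ z) (ℕ→ℚ n) ⟩
    π * (ℕ→ℚ n * v) + ℤ→ℚ z * ℕ→ℚ n      ≡⟨ cong (λ t → π * t + ℤ→ℚ z * ℕ→ℚ n) n*v≡1 ⟩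
    π * 1ℚ + ℤ→ℚ z * ℕ→ℚ n               ≡⟨ cong₂ _+_ (*-identityʳ π) (sym (ℤ→ℚ-* z (+ n))) ⟩
    π + ℤ→ℚ (z ℤ.* + n)                  ≡⟨ ℤ→ℚ-+ (+ p) (z ℤ.* + n) ⟨
    ℤ→ℚ (shifted-numerator z)            ∎
    where open ≡-Reasoning

  p∤shifted-numerator : ∀ z → ¬ (p ∣ ∣ z ∣) → ¬ (p ∣ ∣ shifted-numerator z ∣)
  p∤shifted-numerator z p∤z p∣s = p∤-* z (+ n) p∤z p∤n
    (ℤ∣.∣⇒∣ᵤ (ℤ∣.∣m+n∣m⇒∣n {+ p} {+ p} {z ℤ.* + n} (ℤ∣.∣ᵤ⇒∣ p∣s) ℤ∣.∣-refl))

  integral-inv-shifted : ∀ z → ¬ (p ∣ ∣ z ∣) → Integral p (inv (π * v + ℤ→ℚ z))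
  integral-inv-shifted z p∤z = integral-inv (π * v + ℤ→ℚ z) (+ n) (shifted-numerator z) (p∤shifted-numerator z p∤z) (shifted-clears z)

  shifted≢0 : ∀ z → ¬ (p ∣ ∣ z ∣) → π * v + ℤ→ℚ z ≢ 0ℚ
  shifted≢0 z p∤z = p∤⇒≢0 (π * v + ℤ→ℚ z) (+ n) (shifted-numerator z) (p∤shifted-numerator z p∤z) (shifted-clears z)

  -- For i > 0 this is 1/(1 + p/(n i)), written so that its numerator and denominator match the
  -- factors of the series.
  g : ℕ → ℚ
  g i = ℕ→ℚ i * inv (π * v + ℕ→ℚ i)

  G : ℕ → ℚ
  G zero    = 1ℚ
  G (suc m) = G m * pow (g (suc m)) n

  integral-g : ∀ i → suc i < p → Integral p (g (suc i))
  integral-g i i<p = integral-* (integral-ℕ (suc i)) (integral-inv-shifted (+ suc i) (p∤suc i<p))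

  c : ℚ
  c = triangular n * (π * v * (π * v))

  ideal-c : Ideal p 2 c
  ideal-c = ideal-*ˡ (integral-triangular n) (ideal-* (ideal-*ʳ ideal-p integral-v) (ideal-*ʳ ideal-p integral-v))

  -- `inverse-power` with y = p/(n i). As n y = p/i, the linear part is exactly the ratio in
  -- `w-suc`.
  pow-g : ∀ i → suc i < p → Ideal p 3 (pow (g (suc i)) n - (1ℚ - π * u (suc i) + c * (u (suc i) * u (suc i))))
  pow-g i i<p = subst (Ideal p 3) (cong₂ (λ s t → pow (g (suc i)) n - (1ℚ - s + t)) n*y≡π*u quadratic)
    (inverse-power {y} {g (suc i)} (ideal-*ʳ (ideal-*ʳ ideal-p integral-v) (integral-u i i<p)) (integral-g i i<p) g*[1+y]≡1 n)
    where
    open ≡-Reasoning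
    I U y J : ℚ
    I = ℕ→ℚ (suc i)
    U = u (suc i)
    y = π * v * U
    J = inv (π * v + I)
    n*y≡π*u : ℕ→ℚ n * y ≡ π * U
    n*y≡π*u = begin
      ℕ→ℚ n * (π * v * U)      ≡⟨ solve 4 (λ n π v u → n :* (π :* v :* u) := n :* v :* (π :* u)) refl (ℕ→ℚ n) π v U ⟩
      ℕ→ℚ n * v * (π * U)      ≡⟨ cong (_* (π * U)) n*v≡1 ⟩
      1ℚ * (π * U)             ≡⟨ *-identityˡ (π * U) ⟩
      π * U                    ∎
    quadratic : triangular n * (y * y) ≡ c * (U * U)
    quadratic = solve 3 (λ t a u → t :* (a :* u :* (a :* u)) := t :* (a :* a) :* (u :* u)) refl (triangular n) (π * v) U
    g*[1+y]≡1 : g (suc i) * (1ℚ + y) ≡ 1ℚ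
    g*[1+y]≡1 = begin
      I * J * (1ℚ + π * v * U)         ≡⟨ solve 4 (λ I J a u → I :* J :* (con 1ℚ :+ a :* u) := (I :+ a :* (I :* u)) :* J) refl I J (π * v) U ⟩
      (I + π * v * (I * U)) * J        ≡⟨ cong (λ t → (I + π * v * t) * J) (*-u i) ⟩
      (I + π * v * 1ℚ) * J             ≡⟨ solve 3 (λ I J a → (I :+ a :* con 1ℚ) :* J := (a :+ I) :* J) refl I J (π * v) ⟩
      (π * v + I) * J                  ≡⟨ *-inv (π * v + I) (shifted≢0 (+ suc i) (p∤suc i<p)) ⟩
      1ℚ                               ∎

  -- Multiplying the estimate for m by `pow-g` leaves, besides inherited errors, the cross term w c
  -- (c H + p u) u², with c in p² and the bracket in p.
  G-estimate : ∀ m → m < p → Ideal p 3 (G m - w m * (1ℚ + c * H m))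
  G-estimate zero    _   = subst (Ideal p 3)
    (trans (solve 1 (λ c → con 0ℚ := con 1ℚ :- con 1ℚ :* (con 1ℚ :+ c :* con 0ℚ)) refl c) (cong (λ t → 1ℚ - t * (1ℚ + c * 0ℚ)) (sym (signedBinomial-0 N)))) ideal-0
  G-estimate (suc m) m<p = subst (Ideal p 3)
    (trans
      (solve 7 (λ G w c H γ π u →
          (G :- w :* (con 1ℚ :+ c :* H)) :* γ
            :+ (w :* (con 1ℚ :+ c :* H) :* (γ :- (con 1ℚ :- π :* u :+ c :* (u :* u)))
            :+ w :* (c :* (c :* H :+ π :* u) :* (u :* u)))
          := G :* γ :- w :* (con 1ℚ :- π :* u) :* (con 1ℚ :+ c :* (H :+ u :* u)))
        refl (G m) (w m) c (H m) (pow (g (suc m)) n) π U)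
      (cong (λ t → G m * pow (g (suc m)) n - t * (1ℚ + c * (H m + U * U))) (sym (w-suc m))))
    (ideal-+ (ideal-*ʳ (G-estimate m m<p′) (integral-pow n (integral-g m m<p)))
      (ideal-+ (ideal-*ˡ (integral-* w-int (integral-+ (integral-ℕ 1) (integral-* c-int (integral-H m m<p′)))) (pow-g m m<p))
        (ideal-*ˡ w-int (ideal-*ʳ (ideal-* ideal-c cH+πu) (integral-* (integral-u m m<p) (integral-u m m<p))))))
    where
    U : ℚ
    U = u (suc m)
    m<p′ : m < p
    m<p′ = ℕₚ.<⇒≤ m<p
    w-int : Integral p (w m)
    w-int = integral-signedBinomial N m
    c-int : Integral p c
    c-int = ideal⇒integral ideal-c
    cH+πu : Ideal p 1 (c * H m + π * U)
    cH+πu = ideal-+ (ideal-weaken (ℕ.s≤s ℕ.z≤n) (ideal-*ʳ ideal-c (integral-H m m<p′))) (ideal-*ʳ ideal-p (integral-u m m<p))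

  sum-PG≡0 : Ideal p 3 (sumTo L (λ m → P n r m * G m))
  sum-PG≡0 = subst (Ideal p 3)
    (sumTo-cong L (λ m _ → solve 5 (λ P G w c H →
        -- Four parts: the error of `G-estimate`, the leading sum, and c w P H split at w = (w - 1)
        -- + 1. Since c is in p², the last two need only congruences modulo p.
        P :* (G :- w :* (con 1ℚ :+ c :* H)) :+ (w :* P :+ (c :* ((w :- con 1ℚ) :* (P :* H)) :+ c :* (P :* H))) := P :* G)
      refl (P n r m) (G m) (w m) c (H m)))
    (ideal-sumTo-+ L (λ m → P n r m * (G m - w m * (1ℚ + c * H m))) _
      (ideal-sumTo L (λ m m<L → ideal-*ˡ (integral-P n r m) (G-estimate m (<L⇒<p m<L))))
      (ideal-sumTo-+ L (λ m → w m * P n r m) _ sum-wP≡0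
        (ideal-sumTo-+ L (λ m → c * ((w m - 1ℚ) * (P n r m * H m))) (λ m → c * (P n r m * H m))
          (ideal-sumTo L (λ m m<L → ideal-* ideal-c (ideal-*ʳ (w≡1 m (<L⇒<p m<L)) (integral-* (integral-P n r m) (integral-H m (<L⇒<p m<L))))))
          (subst (Ideal p 3) (sumTo-* L c (λ m → P n r m * H m)) (ideal-* ideal-c sum-PH≡0)))))

  -- The terms of the series.

  x : ℚ
  x = div π (ℕ→ℚ n) - ℕ→ℚ (suc r) + ℕ→ℚ 2

  x-reduce : x ≡ π * v + 1ℚ - ℕ→ℚ r
  x-reduce = trans (cong₂ (λ s t → s - t + ℕ→ℚ 2) (div-inv π (ℕ→ℚ n)) (ℕ→ℚ-suc r))
    (solve 2 (λ a r → a :- (con 1ℚ :+ r) :+ con (ℕ→ℚ 2) := a :+ con 1ℚ :- r) refl (π * v) (ℕ→ℚ r))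

  -- Exhibits each Pochhammer factor as p/n plus an integer, which is 0 exactly at k = r - 1.
  x+k : ∀ k → x + ℕ→ℚ k ≡ π * v + (ℕ→ℚ (suc k) - ℕ→ℚ r)
  x+k k = begin
    x + ℕ→ℚ k                              ≡⟨ cong (_+ ℕ→ℚ k) x-reduce ⟩
    π * v + 1ℚ - ℕ→ℚ r + ℕ→ℚ k             ≡⟨ solve 3 (λ a r k → a :+ con 1ℚ :- r :+ k := a :+ (con 1ℚ :+ k :- r)) refl (π * v) (ℕ→ℚ r) (ℕ→ℚ k) ⟩
    π * v + (1ℚ + ℕ→ℚ k - ℕ→ℚ r)           ≡⟨ cong (λ t → π * v + (t - ℕ→ℚ r)) (ℕ→ℚ-suc k) ⟨
    π * v + (ℕ→ℚ (suc k) - ℕ→ℚ r)          ∎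
    where open ≡-Reasoning

  B : ℕ → ℚ
  B k = pow (inv (poch x k)) n

  B-suc : ∀ k → B (suc k) ≡ B k * pow (inv (x + ℕ→ℚ k)) n
  B-suc k = trans (cong (λ t → pow t n) (inv-* (poch x k) (x + ℕ→ℚ k))) (pow-* (inv (poch x k)) (inv (x + ℕ→ℚ k)) n)

  F : ℕ → ℚ
  F k = pow (poch 1ℚ k) n * B k

  -- All factors involved precede p/n, so their integer shifts are negative and smaller than p in
  -- absolute value.
  integral-B-below : ∀ k → k < r → Integral p (B k)
  integral-B-below zero    _   = integral-pow n (integral-ℕ 1)
  integral-B-below (suc k) k<r = subst (Integral p) (sym (B-suc k))
    (integral-* (integral-B-below k (ℕₚ.<⇒≤ k<r)) (integral-pow n factor))
    where
    open ≡-Reasoning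
    i : ℕ
    -- Chosen so that k + 1 - r = -(i + 1); the truncated subtraction is exact because k + 1 < r.
    i = r ∸ suc (suc k)
    r≡ : suc k ℕ.+ suc i ≡ r
    r≡ = trans (ℕₚ.+-suc (suc k) i) (ℕₚ.m+[n∸m]≡n k<r)
    i<p : suc i < p
    i<p = ℕ.s≤s (ℕₚ.≤-trans (subst (suc i ℕ.≤_) r≡ (ℕₚ.m≤n+m (suc i) (suc k))) (*-<⇒≤ r (ℕₚ.<⇒≤ 2≤n) rn<N))
    at : x + ℕ→ℚ k ≡ π * v + ℤ→ℚ -[1+ i ]
    at = begin
      x + ℕ→ℚ k                                                  ≡⟨ x+k k ⟩
      π * v + (ℕ→ℚ (suc k) - ℕ→ℚ r)                              ≡⟨ cong (λ t → π * v + (ℕ→ℚ (suc k) - t)) (trans (cong ℕ→ℚ (sym r≡)) (ℕ→ℚ-+ (suc k) (suc i))) ⟩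
      π * v + (ℕ→ℚ (suc k) - (ℕ→ℚ (suc k) + ℕ→ℚ (suc i)))        ≡⟨ solve 3 (λ a k i → a :+ (k :- (k :+ i)) := a :+ :- i) refl (π * v) (ℕ→ℚ (suc k)) (ℕ→ℚ (suc i)) ⟩
      π * v + - ℕ→ℚ (suc i)                                      ∎
    factor : Integral p (inv (x + ℕ→ℚ k))
    factor = subst (λ t → Integral p (inv t)) (sym at) (integral-inv-shifted -[1+ i ] (p∤suc i<p))

  -- The factor x + (r - 1) = p / n is the only one divisible by p; it cancels the prefactor pⁿ.
  integral-p^n*B : Integral p (pow π n * B r)
  integral-p^n*B = go r refl
    where
    open ≡-Reasoning
    go : ∀ k → k ≡ r → Integral p (pow π n * B k)
    go zero    _    = integral-* (integral-pow n (integral-ℕ p)) (integral-pow n (integral-ℕ 1))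
    go (suc k) refl = subst (Integral p) (begin
      B k * pow (ℕ→ℚ n) n                                 ≡⟨ cong (λ t → B k * pow t n) cancel ⟨
      B k * pow (π * inv (x + ℕ→ℚ k)) n                   ≡⟨ cong (B k *_) (pow-* π (inv (x + ℕ→ℚ k)) n) ⟩
      B k * (pow π n * pow (inv (x + ℕ→ℚ k)) n)           ≡⟨ solve 3 (λ b a c → b :* (a :* c) := a :* (b :* c)) refl (B k) (pow π n) (pow (inv (x + ℕ→ℚ k)) n) ⟩
      pow π n * (B k * pow (inv (x + ℕ→ℚ k)) n)           ≡⟨ cong (pow π n *_) (B-suc k) ⟨
      pow π n * B (suc k)                                 ∎)
      (integral-* (integral-B-below k ℕₚ.≤-refl) (integral-pow n (integral-ℕ n)))
      where
      cancel : π * inv (x + ℕ→ℚ k) ≡ ℕ→ℚ n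
      cancel = begin
        π * inv (x + ℕ→ℚ k)                                     ≡⟨ cong (λ t → π * inv t) (x+k k) ⟩
        π * inv (π * v + (ℕ→ℚ (suc k) - ℕ→ℚ (suc k)))           ≡⟨ cong (λ t → π * inv t) (solve 2 (λ a s → a :+ (s :- s) := a) refl (π * v) (ℕ→ℚ (suc k))) ⟩
        π * inv (π * v)                                         ≡⟨ cong (π *_) (inv-* π v) ⟩
        π * (inv π * inv v)                                     ≡⟨ *-assoc π (inv π) (inv v) ⟨
        π * inv π * inv v                                       ≡⟨ cong₂ _*_ (*-inv π (ℕ→ℚ-suc≢0 N)) (inv-unique v (ℕ→ℚ n) (trans (*-comm v (ℕ→ℚ n)) n*v≡1)) ⟩
        1ℚ * ℕ→ℚ n                                              ≡⟨ *-identityˡ (ℕ→ℚ n) ⟩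
        ℕ→ℚ n                                                   ∎

  -- Step m multiplies the term by (Z J)^n with Z = m + 1 + r. Of this, `G` takes (I J)^n with I = m
  -- + 1, and the rest, (Z/I)^n, turns `P n r m` into `P n r (m + 1)` by comparing `P-suc` with
  -- `P-shift`.
  F-above : ∀ m → F (r ℕ.+ m) ≡ B r * (P n r m * G m)
  F-above zero    = trans (cong F (ℕₚ.+-identityʳ r))
    (solve 2 (λ a b → a :* b := b :* (a :* con 1ℚ)) refl (pow (poch 1ℚ r) n) (B r))
  F-above (suc m) = begin
    F (r ℕ.+ suc m)
      ≡⟨ cong F (ℕₚ.+-suc r m) ⟩
    pow (poch 1ℚ (r ℕ.+ m) * (1ℚ + ℕ→ℚ (r ℕ.+ m))) n * B (suc (r ℕ.+ m))
      ≡⟨ cong₂ _*_ (pow-* (poch 1ℚ (r ℕ.+ m)) (1ℚ + ℕ→ℚ (r ℕ.+ m)) n) (B-suc (r ℕ.+ m)) ⟩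
    pow (poch 1ℚ (r ℕ.+ m)) n * pow (1ℚ + ℕ→ℚ (r ℕ.+ m)) n * (B (r ℕ.+ m) * pow (inv (x + ℕ→ℚ (r ℕ.+ m))) n)
      ≡⟨ solve 4 (λ a b c d → a :* b :* (c :* d) := a :* c :* (b :* d)) refl (pow (poch 1ℚ (r ℕ.+ m)) n) (pow (1ℚ + ℕ→ℚ (r ℕ.+ m)) n) (B (r ℕ.+ m)) (pow (inv (x + ℕ→ℚ (r ℕ.+ m))) n) ⟩
    F (r ℕ.+ m) * (pow (1ℚ + ℕ→ℚ (r ℕ.+ m)) n * pow (inv (x + ℕ→ℚ (r ℕ.+ m))) n)
      ≡⟨ cong₂ (λ s t → F (r ℕ.+ m) * (pow s n * pow (inv t) n)) numerator denominator ⟩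
    F (r ℕ.+ m) * (pow Z n * pow J n)
      ≡⟨ cong (_* (pow Z n * pow J n)) (F-above m) ⟩
    B r * (P n r m * G m) * (pow Z n * pow J n)
      ≡⟨ solve 5 (λ b q g z j → b :* (q :* g) :* (z :* j) := b :* (q :* z :* g :* j)) refl (B r) (P n r m) (G m) (pow Z n) (pow J n) ⟩
    B r * (P n r m * pow Z n * G m * pow J n)
      ≡⟨ cong (λ t → B r * (t * G m * pow J n)) (trans (sym (P-suc n r m)) (P-shift n r m)) ⟩
    B r * (pow I n * P n r (suc m) * G m * pow J n)
      ≡⟨ solve 5 (λ b i q g j → b :* (i :* q :* g :* j) := b :* (q :* (g :* (i :* j)))) refl (B r) (pow I n) (P n r (suc m)) (G m) (pow J n) ⟩
    B r * (P n r (suc m) * (G m * (pow I n * pow J n)))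
      ≡⟨ cong (λ t → B r * (P n r (suc m) * (G m * t))) (pow-* I J n) ⟨
    B r * (P n r (suc m) * G (suc m)) ∎
    where
    open ≡-Reasoning
    I J Z : ℚ
    I = ℕ→ℚ (suc m)
    J = inv (π * v + I)
    Z = I + ℕ→ℚ r
    numerator : 1ℚ + ℕ→ℚ (r ℕ.+ m) ≡ Z
    numerator = trans (sym (ℕ→ℚ-suc (r ℕ.+ m))) (sym (ℕ→ℚ-suc-+ m r))
    denominator : x + ℕ→ℚ (r ℕ.+ m) ≡ π * v + I
    denominator = trans (x+k (r ℕ.+ m)) (trans (cong (λ t → π * v + (t - ℕ→ℚ r)) (sym (ℕ→ℚ-suc-+ m r)))
      (solve 3 (λ a i r → a :+ (i :+ r :- r) := a :+ i) refl (π * v) I (ℕ→ℚ r)))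

  series≡0 : Ideal p 3 (pow π n * sumTo p (λ k → div (pow (poch 1ℚ k) n) (pow (poch x k) n)))
  series≡0 = subst (Ideal p 3) (begin
    sumTo r (λ k → pow π n * F k) + pow π n * B r * sumTo L (λ m → P n r m * G m)
      ≡⟨ cong₂ _+_ (sym (sumTo-* r (pow π n) F)) (*-assoc (pow π n) (B r) _) ⟩
    pow π n * sumTo r F + pow π n * (B r * sumTo L (λ m → P n r m * G m))
      ≡⟨ *-distribˡ-+ (pow π n) (sumTo r F) (B r * sumTo L (λ m → P n r m * G m)) ⟨
    pow π n * (sumTo r F + B r * sumTo L (λ m → P n r m * G m))
      ≡⟨ cong (λ t → pow π n * (sumTo r F + t)) (trans (sumTo-* L (B r) (λ m → P n r m * G m)) (sumTo-cong L (λ m _ → sym (F-above m)))) ⟩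
    pow π n * (sumTo r F + sumTo L (λ m → F (r ℕ.+ m)))
      ≡⟨ cong (pow π n *_) (sumTo-split r L F) ⟨
    pow π n * sumTo (r ℕ.+ L) F
      ≡⟨ cong (λ k → pow π n * sumTo k F) (trans (ℕₚ.+-comm r L) L+r≡p) ⟩
    pow π n * sumTo p F
      ≡⟨ cong (pow π n *_) (sumTo-cong p (λ k _ → trans (cong (pow (poch 1ℚ k) n *_) (pow-inv (poch x k) n)) (sym (div-inv (pow (poch 1ℚ k) n) (pow (poch x k) n))))) ⟩
    pow π n * sumTo p (λ k → div (pow (poch 1ℚ k) n) (pow (poch x k) n)) ∎)
    (ideal-+
      -- Below r the terms are integral, so the prefactor p^n with n > 2 suffices; above, it is
      -- spent on making `B r` integral.
      (ideal-sumTo r (λ k k<r → ideal-*ʳ (ideal-weaken 2<n (ideal-pow n))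
        (integral-* (integral-pow n (integral-poch k (integral-ℕ 1))) (integral-B-below k k<r))))
      (ideal-*ˡ integral-p^n*B sum-PG≡0))
    where open ≡-Reasoning

theorem1p2 : (n q p : ℕ) → 2 < n → 0 < q → (2 ∣ n ⊎ ¬ (2 ∣ q)) →
    Prime p → n < p → ℕ.suc ((q ∸ 1) ℕ.* n) < p →
    CongMod
    (pow (ℕ→ℚ p) n *
    sumTo p (λ k → div (pow (poch 1ℚ k) n)
    (pow (poch (div (ℕ→ℚ p) (ℕ→ℚ n) - ℕ→ℚ q + ℕ→ℚ 2) k) n)))
    0ℚ p 3
-- Matching on `s≤s` turns p > (q-1)n + 1 into rn + 1 ≤ N, the degree bound for p - 1 differences.
theorem1p2 n (suc r) (suc N) 2<n 0<q parity p-prime n<p (ℕ.s≤s rn<N) =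
  let ideal c c-int s≡ = series≡0 in c , trans (+-identityʳ s) s≡ , integral⇒p∤denominator c-int
  where
  r≤p : r ℕ.≤ suc N
  -- Needed for `suc N ∸ r` to be the true difference.
  r≤p = ℕₚ.m≤n⇒m≤1+n (*-<⇒≤ r (ℕₚ.≤-trans (ℕ.s≤s ℕ.z≤n) 2<n) rn<N)
  open Series N p-prime n r (suc N ∸ r) 2<n n<p parity rn<N (ℕₚ.m∸n+n≡m r≤p)
  s : ℚ
  s = pow π n * sumTo (suc N) (λ k → div (pow (poch 1ℚ k) n) (pow (poch x k) n))
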